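{- Let $B$ be an abelian group equipped with an infinite family of group homomorphisms $r_v\colon B\to B_v$ (indexed by primes $v$ of a number field $F$) into finite abelian groups $B_v$, satisfying Assumptions (A1) and (A2) described in the context. Let $P,Q,R\in B$ be points of infinite order. Then the following are equivalent: (i) for all but finitely many $v$ there exist integers $x,y,z$ with $\gcd(x,y,z)=1$ and a point $T\in B_{\mathrm{tors}}$ such that $r_v(x^2P+y^2Q+z^2R)=r_v(T)$; (ii) there exist integers $x,y,z$ with $\gcd(x,y,z)=1$ and a point $T\in B_{\mathrm{tors}}$ such that $x^2P+y^2Q+z^2R=T$.
   Context: Setting: $F$ is a number field, $B$ an abelian group, and $r_v\colon B\to B_v$ an infinite family of group homomorphisms indexed by primes $v$ of $F$, with each $B_v$ a finite abelian group. $B_{\mathrm{tors}}$ denotes the torsion subgroup of $B$. For $P\in B$, $\mathrm{ord}_v P$ denotes the order of $r_v(P)$ in $B_v$. For a prime $l$ and positive integer $k$, $l^k\parallel n$ means $l^k\mid n$ and $l^{k+1}\nmid n$. Assumption (A1): for every prime number $l$, every sequence $(k_1,\dots,k_m)$ of nonnegative integers, and every points $P_1,\dots,P_m\in B$ linearly independent over $\mathbb{Z}$, there is a set of primes $v$ of $F$ of positive density such that for each $i$, $l^{k_i}\parallel \mathrm{ord}_v P_i$ if $k_i>0$ and $l\nmid \mathrm{ord}_v P_i$ if $k_i=0$. Assumption (A2): for all but finitely many $v$ the restriction of $r_v$ to $B_{\mathrm{tors}}$ is injective. -}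

module Defs where

open import Level using (Level; _⊔_; suc)
open import Algebra.Bundles using (AbelianGroup; CommutativeRing; Semiring)
open import Algebra.Apartness.Bundles using (HeytingField; HeytingCommutativeRing)
open import Algebra.Morphism.Structures using (IsGroupHomomorphism; IsRingHomomorphism)
import Algebra.Definitions.RawMonoid as RawMonoidDefs
import Algebra.Definitions.RawSemiring as RawSemiringDefs
open import Data.Fin.Base using (Fin; toℕ)
open import Data.Integer.Base using (ℤ; +_; -[1+_])
open import Data.List.Base using (List)
open import Data.List.Membership.Propositional using () renaming (_∉_ to _∉ˡ_)
open import Data.List.Relation.Unary.Enumerates.Setoid using (IsEnumeration)
open import Data.Nat.Base as ℕ using (ℕ)
open import Data.Nat.Divisibility using (_∣_; _∤_)
open import Data.Nat.Primality using (Prime)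
open import Data.Product.Base using (Σ-syntax; ∃-syntax; _×_)
open import Data.Rational.Base as ℚ using (ℚ; 0ℚ)
import Data.Rational.Properties as ℚ
open import Data.Sum.Base using (_⊎_)
open import Function.Definitions using (Injective)
open import Relation.Binary.Bundles using (Setoid)
open import Relation.Binary.Core using (Rel)
open import Relation.Binary.PropositionalEquality.Core using (_≡_)
open import Relation.Binary.PropositionalEquality.Properties using (setoid)
open import Relation.Nullary.Negation.Core using (¬_)
open import Relation.Unary using (Pred; _∈_; _∉_; _∩_; _≐_)

private
  variable
    a p ℓ ℓ′ : Level

IsFinite : Setoid a ℓ → Set (a ⊔ ℓ)
IsFinite S = ∃[ xs ] IsEnumeration S xs

-- The subset Q, counted up to _≈_, has exactly n elements.
HasCardinality : {A : Set a} → Rel A ℓ → Pred A p → ℕ → Set (a ⊔ ℓ ⊔ p)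
HasCardinality {A = A} _≈_ Q n =
  Σ[ f ∈ (Fin n → A) ]
    (∀ i → f i ∈ Q) × Injective _≡_ _≈_ f × (∀ x → x ∈ Q → ∃[ i ] f i ≈ x)

AllButFinitelyMany : {V : Set a} → Pred V p → Set (a ⊔ p)
AllButFinitelyMany {V = V} Q = Σ[ E ∈ List V ] (∀ v → v ∉ˡ E → v ∈ Q)

-- Real numbers, given by Cauchy sequences of rationals.
record ℝ : Set where
  field
    seq    : ℕ → ℚ
    cauchy : ∀ ε → 0ℚ ℚ.< ε →
             ∃[ N ] (∀ m n → N ℕ.≤ m → N ℕ.≤ n → ℚ.∣ seq m ℚ.- seq n ∣ ℚ.< ε)

Positive : ℝ → Set
Positive δ = ∃[ ε ] 0ℚ ℚ.< ε × ∃[ N ] (∀ n → N ℕ.≤ n → ε ℚ.≤ ℝ.seq δ n)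

_⟶_ : (ℕ → ℚ) → ℝ → Set
s ⟶ δ = ∀ ε → 0ℚ ℚ.< ε →
        ∃[ N ] (∀ n → N ℕ.≤ n → ℚ.∣ s n ℚ.- ℝ.seq δ n ∣ ℚ.< ε)

-- The value for denominator 0 is irrelevant to limits of densities: it occurs
-- only below the smallest norm of a prime.
ratio : ℕ → ℕ → ℚ
ratio m ℕ.zero      = 0ℚ
ratio m n@(ℕ.suc _) = + m ℚ./ n

-- A field (nontrivial, by the axioms of a Heyting field) which is a
-- finite-dimensional ℚ-algebra.
record NumberField ℓ : Set (suc ℓ) where
  field
    heytingField : HeytingField ℓ ℓ ℓ

  commutativeRing : CommutativeRing ℓ ℓ
  commutativeRing = HeytingCommutativeRing.commutativeRing
    (HeytingField.heytingCommutativeRing heytingField)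

  open CommutativeRing commutativeRing public
  open RawMonoidDefs +-rawMonoid public using (sum)
  open RawSemiringDefs (Semiring.rawSemiring semiring) public using (_^_)

  field
    fromℚ      : ℚ → Carrier
    fromℚ-hom  : IsRingHomomorphism
                   (CommutativeRing.rawRing ℚ.+-*-commutativeRing) rawRing fromℚ
    finite-dim : ∃[ n ] Σ[ e ∈ (Fin n → Carrier) ]
                   (∀ x → Σ[ c ∈ (Fin n → ℚ) ] x ≈ sum (λ i → fromℚ (c i) * e i))

  fromℤ : ℤ → Carrier
  fromℤ k = fromℚ (k ℚ./ 1)

  -- x is a root of the monic polynomial Xⁿ + Σ_{i<n} cᵢ Xⁱ.
  IsIntegral : Pred Carrier ℓ
  IsIntegral x = ∃[ n ] Σ[ c ∈ (Fin n → ℤ) ]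
    x ^ n + sum (λ i → fromℤ (c i) * x ^ toℕ i) ≈ 0#

-- Primes of F: nonzero prime ideals of its ring of integers, as subsets of F.
record PrimeOf {ℓ} (F : NumberField ℓ) : Set (suc ℓ) where
  open NumberField F
  field
    ideal    : Pred Carrier ℓ
    integral : ∀ {x} → x ∈ ideal → x ∈ IsIntegral
    resp     : ∀ {x y} → x ≈ y → x ∈ ideal → y ∈ ideal
    zero∈    : 0# ∈ ideal
    +-closed : ∀ {x y} → x ∈ ideal → y ∈ ideal → x + y ∈ ideal
    *-closed : ∀ {x y} → x ∈ IsIntegral → y ∈ ideal → x * y ∈ ideal
    nonzero  : ∃[ x ] x ∈ ideal × ¬ (x ≈ 0#)
    proper   : 1# ∉ ideal
    prime    : ∀ {x y} → x ∈ IsIntegral → y ∈ IsIntegral →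
               x * y ∈ ideal → x ∈ ideal ⊎ y ∈ ideal

  _≈mod_ : Rel Carrier ℓ
  x ≈mod y = x - y ∈ ideal

  -- The norm is the cardinality of the residue ring.
  HasNorm : ℕ → Set ℓ
  HasNorm = HasCardinality _≈mod_ IsIntegral

module _ {ℓ} {F : NumberField ℓ} where

  _≐ᴾ_ : Rel (PrimeOf F) ℓ
  𝔭 ≐ᴾ 𝔮 = PrimeOf.ideal 𝔭 ≐ PrimeOf.ideal 𝔮

  NormAtMost : ℕ → Pred (PrimeOf F) ℓ
  NormAtMost x 𝔭 = ∃[ n ] n ℕ.≤ x × PrimeOf.HasNorm 𝔭 n

  -- Natural density: the limit, as x → ∞, of the proportion of the primes of
  -- norm ≤ x lying in S.
  HasDensity : Pred (PrimeOf F) ℓ → ℝ → Set (suc ℓ)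
  HasDensity S δ =
    Σ[ num ∈ (ℕ → ℕ) ] Σ[ den ∈ (ℕ → ℕ) ]
      (∀ x → HasCardinality _≐ᴾ_ (S ∩ NormAtMost x) (num x)) ×
      (∀ x → HasCardinality _≐ᴾ_ (NormAtMost x) (den x)) ×
      (λ x → ratio (num x) (den x)) ⟶ δ

  HasPositiveDensity : Pred (PrimeOf F) ℓ → Set (suc ℓ)
  HasPositiveDensity S = ∃[ δ ] Positive δ × HasDensity S δ

module GroupNotions {c ℓ} (G : AbelianGroup c ℓ) where
  open AbelianGroup G
  open RawMonoidDefs rawMonoid public using (sum) renaming (_×_ to _·ℕ_)

  infixr 8 _·_
  _·_ : ℤ → Carrier → Carrier
  (+ n)    · g = n ·ℕ g
  -[1+ n ] · g = (ℕ.suc n ·ℕ g) ⁻¹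

  IsTorsion : Pred Carrier ℓ
  IsTorsion g = ∃[ n ] 0 ℕ.< n × n ·ℕ g ≈ ε

  HasInfiniteOrder : Pred Carrier ℓ
  HasInfiniteOrder g = ¬ IsTorsion g

  IsOrder : Carrier → ℕ → Set ℓ
  IsOrder g n =
    0 ℕ.< n × n ·ℕ g ≈ ε × (∀ m → 0 ℕ.< m → m ·ℕ g ≈ ε → n ℕ.≤ m)

  LinearlyIndependent : ∀ {m} → (Fin m → Carrier) → Set ℓ
  LinearlyIndependent {m} P =
    ∀ (c : Fin m → ℤ) → sum (λ i → c i · P i) ≈ ε → ∀ i → c i ≡ + 0

_^_∥_ : ℕ → ℕ → ℕ → Set
l ^ k ∥ n = (l ℕ.^ k) ∣ n × (l ℕ.^ ℕ.suc k) ∤ n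

-- An infinite family of homomorphisms r_v : B → B_v into finite abelian groups,
-- indexed by an infinite set of primes of F. The indexing set is given by a type
-- injecting into the primes, so some primes (e.g. of bad reduction) may be left out.
record ReductionFamily {ℓ} (F : NumberField ℓ) (B : AbelianGroup ℓ ℓ) : Set (suc ℓ) where
  field
    Index           : Set ℓ
    index-infinite  : ¬ IsFinite (setoid Index)
    primeAt         : Index → PrimeOf F
    primeAt-inj     : Injective _≡_ _≐ᴾ_ primeAt
    target          : Index → AbelianGroup ℓ ℓ
    target-finite   : ∀ v → IsFinite (AbelianGroup.setoid (target v))
    red             : ∀ v → AbelianGroup.Carrier B → AbelianGroup.Carrier (target v)
    red-hom         : ∀ v → IsGroupHomomorphism
                        (AbelianGroup.rawGroup B) (AbelianGroup.rawGroup (target v)) (red v)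

  open AbelianGroup B using (Carrier; _≈_)
  open GroupNotions B using (IsTorsion; LinearlyIndependent)

  infix 4 _≈[_]_
  _≈[_]_ : Carrier → Index → Carrier → Set ℓ
  P ≈[ v ] Q = AbelianGroup._≈_ (target v) (red v P) (red v Q)

  HasOrd : Index → Carrier → ℕ → Set ℓ
  HasOrd v P = GroupNotions.IsOrder (target v) (red v P)

  primesAt : Pred Index ℓ → Pred (PrimeOf F) ℓ
  primesAt S 𝔭 = ∃[ v ] v ∈ S × primeAt v ≐ᴾ 𝔭

  A1 : Set (suc ℓ)
  A1 = ∀ (l : ℕ) → Prime l → ∀ (m : ℕ) (k : Fin m → ℕ) (P : Fin m → Carrier) →
       LinearlyIndependent P →
       Σ[ S ∈ Pred Index ℓ ] HasPositiveDensity (primesAt S) ×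
         (∀ v → v ∈ S → ∀ i → ∃[ n ] HasOrd v (P i) n ×
           (0 ℕ.< k i → l ^ k i ∥ n) × (k i ≡ 0 → l ∤ n))

  A2 : Set ℓ
  A2 = AllButFinitelyMany λ v →
       ∀ T T′ → IsTorsion T → IsTorsion T′ → T ≈[ v ] T′ → T ≈ T′

{-# OPTIONS --safe #-}

-- Only (i) ⇒ (ii) needs an argument. Suppose G₀, …, G_m are independent and, up to
-- relations between P, Q and R, d (x²P + y²Q + z²R) = q(x, y, z) G₀ + Σ sᵢ Gᵢ with a
-- diagonal ternary form q. Choosing v by (A1) so that a large power of l divides
-- ord_v G₀ while the other orders are prime to l, (i) yields primitive zeros of q
-- modulo every power of every prime l.
--
-- * P, Q, R independent: take G = (P, Q − P, R − P). Then q = x² + y² + z², which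
--   has no primitive zero modulo 4.
-- * Rank 2, αP + βQ + γR = 0 with γ ≠ 0 and P, Q independent: take G = (P, Q − cP)
--   for c any integer. If αγ is not a square, some choice of c makes the form
--   anisotropic at a prime l (l = 2 if −αγ is a square, otherwise l divides the
--   squarefree part of αγ). So αγ is a square, likewise βγ, and (√αγ, √βγ, γ)
--   divided by its content solves (ii).
-- * Rank 1: take G = (P). The form q is isotropic at every prime, hence isotropic
--   over ℤ by the Hasse principle. No condition at the real place is needed: in the
--   descent for z² = a x² + b y² the definite terminal case a = b = −1 is already
--   excluded at 2.
module Submission where

open import Defs
open import Algebra.Bundles using (AbelianGroup)
open import Algebra.Morphism.Structures using (IsGroupHomomorphism)
import Algebra.Properties.AbelianGroup as AbelianGroupProperties
import Algebra.Properties.CommutativeMonoid.Mult as Mult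
import Algebra.Properties.CommutativeSemigroup as CommutativeSemigroupProperties
import Algebra.Properties.Group as GroupProperties
open import Axiom.ExcludedMiddle using (ExcludedMiddle)
open import Data.Empty using (⊥; ⊥-elim)
open import Data.Fin.Base as Fin using (Fin; toℕ; fromℕ<)
import Data.Fin.Properties as Fin
open import Data.Integer.Base as ℤ
  using (ℤ; +_; -[1+_]; 0ℤ; 1ℤ; -1ℤ; _+_; _*_; -_; _-_; _^_)
open import Data.Integer.Divisibility.Signed
open import Data.Integer.DivMod using (_%ℕ_; _/ℕ_; a≡a%ℕn+[a/ℕn]*n; n%ℕd<d)
open import Data.Integer.GCD
  using (gcd; gcd[i,j]∣i; gcd[i,j]∣j; gcd-greatest; gcd[i,j]≡0⇒i≡0; gcd[i,j]≡0⇒j≡0)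
import Data.Integer.Properties as ℤ
open import Data.Integer.Tactic.RingSolver using (solve-∀)
open import Data.List.Base using (List; []; _∷_; length)
open import Data.List.Membership.Propositional using (_∉_) renaming (_∈_ to _∈ˡ_)
import Data.List.Membership.Setoid as Membership
import Data.List.Membership.Setoid.Properties as Membershipₚ
open import Data.List.Relation.Unary.All using (All; []; _∷_)
open import Data.List.Relation.Unary.Any as Any using (here; there)
open import Data.Nat.Base as ℕ using (ℕ; zero; suc; z≤n; s≤s)
open import Data.Nat.Coprimality using (Coprime; coprime-Bézout)
import Data.Nat.Divisibility as ℕᵈ
open import Data.Nat.GCD using (module Bézout)
open import Data.Nat.Induction using (<-rec)
open import Data.Nat.ListAction using (product)
open import Data.Nat.Primality
  using (Prime; prime?; euclidsLemma; prime⇒nonZero; prime⇒nonTrivial; prime⇒irreducible)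
open import Data.Nat.Primality.Factorisation using (factorise; PrimeFactorisation)
import Data.Nat.Properties as ℕ
open import Data.Product.Base using (Σ-syntax; ∃-syntax; _×_; _,_; proj₁; proj₂)
open import Data.Rational.Base as ℚ using (ℚ; 0ℚ; ½; mkℚ)
import Data.Rational.Properties as ℚ
import Data.Rational.Unnormalised.Base as ℚᵘ
import Data.Rational.Unnormalised.Properties as ℚᵘ
open import Data.Sum.Base using (_⊎_; inj₁; inj₂; [_,_]′)
open import Data.Unit.Polymorphic.Base using (⊤)
import Data.Vec.Functional as Vector
open import Function.Base using (id; _∘_)
open import Function.Bundles using (_⇔_; mk⇔)
open import Function.Definitions using (Injective)
open import Level using (0ℓ; Lift; lift; lower)
open import Relation.Binary.Core using (Rel)
open import Relation.Binary.Definitions using (Symmetric; Transitive)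
open import Relation.Binary.PropositionalEquality as ≡
  using (_≡_; _≢_; module ≡-Reasoning)
open import Relation.Nullary using (¬_; Dec; yes; no; contradiction)
open import Relation.Nullary.Decidable using (decidable-stable; from-yes; from-no; map′)
open import Relation.Unary using (Pred; _∈_; _∩_)

open AbelianGroupProperties ℚ.+-0-abelianGroup using (⁻¹-anti-homo‿-)
open GroupProperties ℚ.+-0-group using (//-rightDividesʳ)

-- Two obstacles separate (i) from congruences. The torsion point varies with v; but one good v
-- embeds the torsion of B into a finite group, so a single n kills all of it, and multiplying by n
-- costs only a bounded power of l. Further, (A1) yields a set of positive density, while a v
-- outside a finite exceptional set is wanted; that such a v is left is derived from (A1) itself,
-- which produces arbitrarily many primes. Only the coefficient of one basis point is read off from
-- each choice of basis. In rank 2 the parameter c compensates for this: it is chosen so that c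
-- contributes a prescribed square class while the term involving β becomes a perturbation that
-- cannot be seen at l. Isotropy at l is expressed by congruences modulo all powers of l. Changes of
-- form are integral maps invertible over the rationals, so that local zeros can be pushed forward
-- and global ones brought back.

private
  variable
    l : ℕ

-- Cancelling factors in divisibility by prime powers

prime>1 : Prime l → 1 ℕ.< l
prime>1 {suc (suc l)} pl = s≤s (s≤s z≤n)
prime>1 {0} pl = contradiction (prime⇒nonTrivial pl) λ ()
prime>1 {1} pl = contradiction (prime⇒nonTrivial pl) λ ()

^-monoʳ-∣ : ∀ l {m n} → m ℕ.≤ n → (l ℕ.^ m) ℕᵈ.∣ (l ℕ.^ n)
^-monoʳ-∣ l {m} m≤n with ℕ.m≤n⇒∃[o]m+o≡n m≤n
... | o , ≡.refl = ≡.subst (l ℕ.^ m ℕᵈ.∣_) (≡.sym (ℕ.^-distribˡ-+-* l m o)) (ℕᵈ.m∣m*n _)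

ℕ-prime-power-cancel : Prime l → ∀ {m} → ¬ l ℕᵈ.∣ m → ∀ n {q} →
                       (l ℕ.^ n) ℕᵈ.∣ (m ℕ.* q) → (l ℕ.^ n) ℕᵈ.∣ q
ℕ-prime-power-cancel pl l∤m zero _ = ℕᵈ.1∣ _
ℕ-prime-power-cancel {l} pl {m} l∤m (suc n) {q} h
  with euclidsLemma m q pl (ℕᵈ.∣-trans (ℕᵈ.m∣m*n (l ℕ.^ n)) h)
... | inj₁ l∣m = contradiction l∣m l∤m
... | inj₂ (ℕᵈ.divides q′ ≡.refl) =
  ≡.subst ((l ℕ.* l ℕ.^ n) ℕᵈ.∣_) (ℕ.*-comm l q′) (ℕᵈ.*-monoʳ-∣ l
    (ℕ-prime-power-cancel pl l∤m n (ℕᵈ.*-cancelˡ-∣ l ⦃ prime⇒nonZero pl ⦄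
      (≡.subst (l ℕ.* l ℕ.^ n ℕᵈ.∣_)
        (≡.trans (≡.sym (ℕ.*-assoc m q′ l)) (ℕ.*-comm (m ℕ.* q′) l)) h))))

-- The exponent of `l` in `t` is less than `t`, so giving up `t` powers of `l` is more than enough.
-- This crude loss, uniform in `k`, replaces valuations; the induction strips one factor `l` from
-- `t` at a time.
ℕ-power-cancel : Prime l → ∀ t → 0 ℕ.< t → ∀ k {q} →
                 (l ℕ.^ (k ℕ.+ t)) ℕᵈ.∣ (t ℕ.* q) → (l ℕ.^ k) ℕᵈ.∣ q
ℕ-power-cancel {l} pl = <-rec _ step
  where
  instance _ = prime⇒nonZero pl
  step : ∀ t → (∀ {u} → u ℕ.< t → 0 ℕ.< u → ∀ k {q} →
           (l ℕ.^ (k ℕ.+ u)) ℕᵈ.∣ (u ℕ.* q) → (l ℕ.^ k) ℕᵈ.∣ q) →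
         0 ℕ.< t → ∀ k {q} →
         (l ℕ.^ (k ℕ.+ t)) ℕᵈ.∣ (t ℕ.* q) → (l ℕ.^ k) ℕᵈ.∣ q
  step t rec 0<t k {q} h with l ℕᵈ.∣? t
  ... | no l∤t = ℕ-prime-power-cancel pl l∤t k
    (ℕᵈ.∣-trans (^-monoʳ-∣ l (ℕ.m≤m+n k t)) h)
  ... | yes (ℕᵈ.divides zero ≡.refl) = contradiction 0<t λ ()
  ... | yes (ℕᵈ.divides u@(suc _) ≡.refl) =
    rec u<ul (s≤s z≤n) k (ℕᵈ.*-cancelˡ-∣ l
      (ℕᵈ.∣-trans (^-monoʳ-∣ l exp≤) (≡.subst (l ℕ.^ (k ℕ.+ u ℕ.* l) ℕᵈ.∣_) eq h)))
    where
    u<ul : u ℕ.< u ℕ.* l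
    u<ul = ℕ.m<m*n u l (prime>1 pl)
    exp≤ : suc (k ℕ.+ u) ℕ.≤ k ℕ.+ u ℕ.* l
    exp≤ = ≡.subst (ℕ._≤ k ℕ.+ u ℕ.* l) (ℕ.+-suc k u) (ℕ.+-monoʳ-≤ k u<ul)
    eq : u ℕ.* l ℕ.* q ≡ l ℕ.* (u ℕ.* q)
    eq = ≡.trans (≡.cong (ℕ._* q) (ℕ.*-comm u l)) (ℕ.*-assoc l u q)

euclid : Prime l → ∀ x y → + l ∣ x * y → + l ∣ x ⊎ + l ∣ y
euclid {l} pl x y h
  with euclidsLemma ℤ.∣ x ∣ ℤ.∣ y ∣ pl (≡.subst (l ℕᵈ.∣_) (ℤ.abs-* x y) (∣⇒∣ᵤ h))
... | inj₁ d = inj₁ (∣ᵤ⇒∣ d)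
... | inj₂ d = inj₂ (∣ᵤ⇒∣ d)

euclid² : Prime l → ∀ x → + l ∣ x * x → + l ∣ x
euclid² pl x h = [ id , id ]′ (euclid pl x x h)

prime-power-cancel : Prime l → ∀ {m} → ¬ + l ∣ m → ∀ n {q} →
                     + (l ℕ.^ n) ∣ m * q → + (l ℕ.^ n) ∣ q
prime-power-cancel {l} pl {m} l∤m n {q} h = ∣ᵤ⇒∣ (ℕ-prime-power-cancel pl
  (λ d → l∤m (∣ᵤ⇒∣ d)) n (≡.subst ((l ℕ.^ n) ℕᵈ.∣_) (ℤ.abs-* m q) (∣⇒∣ᵤ h)))

power-cancel : Prime l → ∀ {t} → t ≢ 0ℤ → ∀ k {q} →
               + (l ℕ.^ (k ℕ.+ ℤ.∣ t ∣)) ∣ t * q → + (l ℕ.^ k) ∣ q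
power-cancel {l} pl {t} t≢0 k {q} h = ∣ᵤ⇒∣ (ℕ-power-cancel pl ℤ.∣ t ∣
  (ℕ.n≢0⇒n>0 (λ e → t≢0 (ℤ.∣i∣≡0⇒i≡0 e))) k
  (≡.subst ((l ℕ.^ (k ℕ.+ ℤ.∣ t ∣)) ℕᵈ.∣_) (ℤ.abs-* t q) (∣⇒∣ᵤ h)))

*-≢0 : ∀ {x y} → x ≢ 0ℤ → y ≢ 0ℤ → x * y ≢ 0ℤ
*-≢0 {x} x≢0 y≢0 e with ℤ.i*j≡0⇒i≡0∨j≡0 x e
... | inj₁ p = x≢0 p
... | inj₂ p = y≢0 p

∣-diff : ∀ {d x} y → d ∣ x - y → d ∣ y → d ∣ x
∣-diff {d} {x} y h h′ = ≡.subst (d ∣_) (eq x y) (∣m∣n⇒∣m+n h h′)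
  where
  eq : ∀ x y → x - y + y ≡ x
  eq = solve-∀

-- Diagonal ternary forms

ℤ³ : Set
ℤ³ = ℤ × ℤ × ℤ

infix 4 _∣³_
_∣³_ : ℤ → ℤ³ → Set
d ∣³ (x , y , z) = d ∣ x × d ∣ y × d ∣ z

infixr 7 _*³_
_*³_ : ℤ → ℤ³ → ℤ³
d *³ (x , y , z) = d * x , d * y , d * z

diag : ℤ³ → ℤ³ → ℤ
diag (a , b , c) (x , y , z) = a * (x * x) + b * (y * y) + c * (z * z)

-- Asking for l ^ j ∤ v with a fixed j, rather than for l ∤ v, makes the notion
-- invariant under the maps of Transfer, which need not preserve primitivity.
IsotropicAt : ℕ → ℤ³ → Set
IsotropicAt l q = ∃[ j ] ∀ k → ∃[ v ] + (l ℕ.^ k) ∣ diag q v × ¬ + (l ℕ.^ j) ∣³ v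

LocallyIsotropic : ℤ³ → Set
LocallyIsotropic q = ∀ {l} → Prime l → IsotropicAt l q

-- 0 ∣³ v says that v = 0.
Isotropic : ℤ³ → Set
Isotropic q = ∃[ v ] diag q v ≡ 0ℤ × ¬ 0ℤ ∣³ v

-- The divisibility d ∣³ map v ⇒ d ∣³ det · v controls primitivity at a prime, and
-- for d = 0 it says that map v = 0 only for v = 0.
record Transfer (q q′ : ℤ³) : Set where
  field
    map      : ℤ³ → ℤ³
    factor   : ℤ
    det      : ℤ
    det≢0    : det ≢ 0ℤ
    diag-map : ∀ v → diag q′ (map v) ≡ factor * diag q v
    reflects : ∀ d v → d ∣³ map v → d ∣³ det *³ v

module _ {q q′} (T : Transfer q q′) where
  open Transfer T

  -- By `reflects`, passing to the image enlarges the common power of `l` by at most the `l`-part of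
  -- `det`, whose exponent is bounded by the absolute value of `det`.
  transfer-isotropicAt : Prime l → IsotropicAt l q → IsotropicAt l q′
  transfer-isotropicAt {l} pl (j , sol) = j ℕ.+ ℤ.∣ det ∣ , λ k →
    let v , h , l∤v = sol k in
    map v , ≡.subst (+ (l ℕ.^ k) ∣_) (≡.sym (diag-map v)) (∣n⇒∣m*n factor h) ,
    λ d → let dx , dy , dz = reflects _ v d in
      l∤v (power-cancel pl det≢0 j dx , power-cancel pl det≢0 j dy , power-cancel pl det≢0 j dz)

  transfer-isotropic : Isotropic q → Isotropic q′
  transfer-isotropic (v , h , v≢0) =
    map v , ≡.trans (diag-map v) (≡.trans (≡.cong (factor *_) h) (ℤ.*-zeroʳ factor)) ,
    λ d → let dx , dy , dz = reflects _ v d in v≢0 (cancel dx , cancel dy , cancel dz)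
    where
    cancel : ∀ {x} → 0ℤ ∣ det * x → 0ℤ ∣ x
    cancel {x} d with ℤ.i*j≡0⇒i≡0∨j≡0 det (0∣⇒≡0 d)
    ... | inj₁ e = contradiction e det≢0
    ... | inj₂ e = ∣-reflexive (≡.sym e)

infix 4 _∣³?_
_∣³?_ : ∀ d v → Dec (d ∣³ v)
d ∣³? (x , y , z) with d ∣? x | d ∣? y | d ∣? z
... | yes p | yes r | yes s = yes (p , r , s)
... | no ¬p | _ | _ = no λ h → ¬p (proj₁ h)
... | _ | no ¬p | _ = no λ h → ¬p (proj₁ (proj₂ h))
... | _ | _ | no ¬p = no λ h → ¬p (proj₂ (proj₂ h))

diag-scale : ∀ q d v → diag q (d *³ v) ≡ d * (d * diag q v)
diag-scale (a , b , c) d (x , y , z) = eq a b c d x y z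
  where
  eq : ∀ a b c d x y z →
       a * (d * x * (d * x)) + b * (d * y * (d * y)) + c * (d * z * (d * z)) ≡
       d * (d * (a * (x * x) + b * (y * y) + c * (z * z)))
  eq = solve-∀

pos-^-suc : ∀ l j → + (l ℕ.^ suc j) ≡ + l * + (l ℕ.^ j)
pos-^-suc l j = ℤ.pos-* l (l ℕ.^ j)

-- A common factor `l` of the coordinates puts `l²` into the value of the form, and fewer than `j`
-- such factors can be removed; hence the starting exponent `k + 2j`.
primitive-solution : Prime l → ∀ q → IsotropicAt l q →
                     ∀ k → ∃[ v ] + (l ℕ.^ k) ∣ diag q v × ¬ + l ∣³ v
primitive-solution {l} pl q (j , sol) k =
  let v , h , n = sol (k ℕ.+ 2 ℕ.* j) in divide j v h n
  where
  instance _ = prime⇒nonZero pl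
  divide : ∀ j v → + (l ℕ.^ (k ℕ.+ 2 ℕ.* j)) ∣ diag q v → ¬ + (l ℕ.^ j) ∣³ v →
           ∃[ v ] + (l ℕ.^ k) ∣ diag q v × ¬ + l ∣³ v
  divide zero (x , y , z) h n =
    contradiction (∣ᵤ⇒∣ (ℕᵈ.1∣ _) , ∣ᵤ⇒∣ (ℕᵈ.1∣ _) , ∣ᵤ⇒∣ (ℕᵈ.1∣ _)) n
  divide (suc j) v h n with + l ∣³? v
  ... | no l∤v = v , ∣-trans (∣ᵤ⇒∣ (^-monoʳ-∣ l (ℕ.m≤m+n k _))) h , l∤v
  ... | yes (divides x ≡.refl , divides y ≡.refl , divides z ≡.refl) =
    divide j (x , y , z) h′ n′
    where
    exp : k ℕ.+ 2 ℕ.* suc j ≡ suc (suc (k ℕ.+ 2 ℕ.* j))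
    exp = ≡.trans (≡.cong (k ℕ.+_) (≡.cong suc (ℕ.+-suc j (j ℕ.+ 0))))
      (≡.trans (ℕ.+-suc k _) (≡.cong suc (ℕ.+-suc k _)))
    eqv : (x * + l , y * + l , z * + l) ≡ + l *³ (x , y , z)
    eqv = ≡.cong₂ _,_ (ℤ.*-comm x (+ l)) (≡.cong₂ _,_ (ℤ.*-comm y (+ l)) (ℤ.*-comm z (+ l)))
    eqp : + (l ℕ.^ (k ℕ.+ 2 ℕ.* suc j)) ≡ + l * (+ l * + (l ℕ.^ (k ℕ.+ 2 ℕ.* j)))
    eqp = ≡.trans (≡.cong (λ e → + (l ℕ.^ e)) exp) (≡.trans (pos-^-suc l (suc (k ℕ.+ 2 ℕ.* j)))
      (≡.cong (+ l *_) (pos-^-suc l (k ℕ.+ 2 ℕ.* j))))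
    h′ : + (l ℕ.^ (k ℕ.+ 2 ℕ.* j)) ∣ diag q (x , y , z)
    h′ = *-cancelˡ-∣ (+ l) (*-cancelˡ-∣ (+ l) (≡.subst₂ _∣_ eqp
           (≡.trans (≡.cong (diag q) eqv) (diag-scale q (+ l) (x , y , z))) h))
    n′ : ¬ + (l ℕ.^ j) ∣³ (x , y , z)
    n′ (dx , dy , dz) = n (up dx , up dy , up dz)
      where
      up : ∀ {x} → + (l ℕ.^ j) ∣ x → + (l ℕ.^ suc j) ∣ x * + l
      up {x} d = ≡.subst₂ _∣_ (≡.sym (pos-^-suc l j)) (ℤ.*-comm (+ l) x) (*-monoʳ-∣ (+ l) d)

-- Inverses and square roots modulo primes and squarefree products

prime-coprime : Prime l → ∀ {m} → ¬ l ℕᵈ.∣ m → Coprime l m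
prime-coprime pl l∤m (d∣l , d∣m) with prime⇒irreducible pl d∣l
... | inj₁ d≡1 = d≡1
... | inj₂ ≡.refl = contradiction d∣m l∤m

inverse-ℕ : ∀ {m} → Coprime l m → ∃[ y ] + l ∣ + m * y - 1ℤ
inverse-ℕ {l} {m} c with coprime-Bézout c
... | Bézout.+- x y eq = - + y , divides (- + x) (begin
  + m * - + y - 1ℤ           ≡⟨ lem (+ m) (+ y) ⟩
  - (1ℤ + + y * + m)         ≡⟨ ≡.cong (λ e → - (1ℤ + e)) (ℤ.pos-* y m) ⟨
  - (+ (1 ℕ.+ y ℕ.* m))      ≡⟨ ≡.cong (λ e → - + e) eq ⟩
  - (+ (x ℕ.* l))            ≡⟨ ≡.cong -_ (ℤ.pos-* x l) ⟩
  - (+ x * + l)              ≡⟨ ℤ.neg-distribˡ-* (+ x) (+ l) ⟩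
  - + x * + l                ∎)
  where
  open ≡-Reasoning
  lem : ∀ m y → m * - y - 1ℤ ≡ - (1ℤ + y * m)
  lem = solve-∀
... | Bézout.-+ x y eq = + y , divides (+ x) (begin
  + m * + y - 1ℤ             ≡⟨ ≡.cong (_- 1ℤ) (ℤ.*-comm (+ m) (+ y)) ⟩
  + y * + m - 1ℤ             ≡⟨ ≡.cong (_- 1ℤ) (ℤ.pos-* y m) ⟨
  + (y ℕ.* m) - 1ℤ           ≡⟨ ≡.cong (λ e → + e - 1ℤ) eq ⟨
  + (1 ℕ.+ x ℕ.* l) - 1ℤ     ≡⟨ ≡.cong (λ e → 1ℤ + e - 1ℤ) (ℤ.pos-* x l) ⟩
  1ℤ + + x * + l - 1ℤ        ≡⟨ lem (+ x * + l) ⟩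
  + x * + l                  ∎)
  where
  open ≡-Reasoning
  lem : ∀ e → 1ℤ + e - 1ℤ ≡ e
  lem = solve-∀

inverse-mod : Prime l → ∀ {x} → ¬ + l ∣ x → ∃[ y ] + l ∣ x * y - 1ℤ
inverse-mod {l} pl {+ n} l∤x = inverse-ℕ (prime-coprime pl (λ d → l∤x (∣ᵤ⇒∣ d)))
inverse-mod {l} pl { -[1+ n ]} l∤x
  with y , h ← inverse-ℕ (prime-coprime pl {suc n} (λ d → l∤x (∣ᵤ⇒∣ d))) =
  - y , ≡.subst (λ e → + l ∣ e - 1ℤ) (lem (+ suc n) y) h
  where
  lem : ∀ a y → a * y ≡ - a * - y
  lem = solve-∀

IsSquareMod : ℤ → ℤ → Set
IsSquareMod m a = ∃[ t ] m ∣ t * t - a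

sqrt-mod-prime : Prime l → ∀ a {x z} → ¬ + l ∣ x → + l ∣ z * z - a * (x * x) →
                 IsSquareMod (+ l) a
sqrt-mod-prime {l} pl a {x} {z} l∤x h with y , (divides k e) ← inverse-mod pl l∤x =
  z * y , ≡.subst (+ l ∣_) (lem a x y z) (∣m∣n⇒∣m+n (∣m⇒∣m*n (y * y) h)
    (∣n⇒∣m*n (a * (x * y + 1ℤ)) (divides k e)))
  where
  lem : ∀ a x y z → (z * z - a * (x * x)) * (y * y) + a * (x * y + 1ℤ) * (x * y - 1ℤ) ≡
        z * y * (z * y) - a
  lem = solve-∀

Squarefree : ℤ → Set
Squarefree a = ∀ {p} → Prime p → ¬ + p * + p ∣ a

-- The bound on `a₀` serves the descent: passing to the squarefree part must not undo the decrease
-- of the coefficient.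
SquarefreeDecomposition : ℤ → Set
SquarefreeDecomposition a = ∃[ a₀ ] ∃[ s ]
  a ≡ a₀ * (s * s) × s ≢ 0ℤ × Squarefree a₀ × ℤ.∣ a₀ ∣ ℕ.≤ ℤ.∣ a ∣

module Classical (em : ExcludedMiddle 0ℓ) where

  squarefree-decomposition : ∀ a → a ≢ 0ℤ → SquarefreeDecomposition a
  squarefree-decomposition a = <-rec
    (λ n → ∀ a → ℤ.∣ a ∣ ≡ n → a ≢ 0ℤ → SquarefreeDecomposition a) step ℤ.∣ a ∣ a ≡.refl
    where
    step : ∀ n →
           (∀ {m} → m ℕ.< n → ∀ a → ℤ.∣ a ∣ ≡ m → a ≢ 0ℤ → SquarefreeDecomposition a) →
           ∀ a → ℤ.∣ a ∣ ≡ n → a ≢ 0ℤ → SquarefreeDecomposition a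
    step n rec a ≡.refl a≢0 with em {∃[ p ] Prime p × + p * + p ∣ a}
    ... | no ¬h = a , 1ℤ , ≡.sym (ℤ.*-identityʳ a) , (λ ()) , (λ pp d → ¬h (_ , pp , d)) , ℕ.≤-refl
    ... | yes (p , pp , divides b ≡.refl) =
      let a₀ , s , e , s≢0 , sf , a₀≤b = rec b<a b ≡.refl b≢0 in
      a₀ , s * + p , ≡.trans (≡.cong (_* (+ p * + p)) e) (lem a₀ s (+ p)) , *-≢0 s≢0 p≢0 , sf ,
      ℕ.≤-trans a₀≤b (ℕ.<⇒≤ b<a)
      where
      p≢0 : + p ≢ 0ℤ
      p≢0 ≡.refl = contradiction (prime⇒nonZero pp) λ ()
      b≢0 : b ≢ 0ℤ
      b≢0 ≡.refl = a≢0 ≡.refl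
      b<a : ℤ.∣ b ∣ ℕ.< ℤ.∣ b * (+ p * + p) ∣
      b<a = ≡.subst (ℤ.∣ b ∣ ℕ.<_)
        (≡.sym (≡.trans (ℤ.abs-* b (+ p * + p)) (≡.cong (ℤ.∣ b ∣ ℕ.*_) (ℤ.abs-* (+ p) (+ p)))))
        (ℕ.m<m*n ℤ.∣ b ∣ (p ℕ.* p) ⦃ ℤ.≢-nonZero b≢0 ⦄
          (ℕ.≤-trans (prime>1 pp) (ℕ.m≤m*n p p ⦃ prime⇒nonZero pp ⦄)))
      lem : ∀ a s p → a * (s * s) * (p * p) ≡ a * (s * p * (s * p))
      lem = solve-∀

prime-divisor : ∀ n → 1 ℕ.< n → ∃[ p ] Prime p × p ℕᵈ.∣ n
prime-divisor n 1<n = go (factorise n ⦃ ℕ.>-nonZero (ℕ.<-trans (s≤s z≤n) 1<n) ⦄)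
  where
  go : PrimeFactorisation n → ∃[ p ] Prime p × p ℕᵈ.∣ n
  go record { factors = [] ; isFactorisation = ≡.refl } = contradiction 1<n λ { (s≤s ()) }
  go record { factors = p ∷ ps ; isFactorisation = e ; factorsPrime = pp ∷ _ } =
    p , pp , ≡.subst (p ℕᵈ.∣_) (≡.sym e) (ℕᵈ.m∣m*n (product ps))

-- Chinese remainder theorem: with `y` inverse to `N` modulo `p`, the number `t + N y (s − t)` is
-- congruent to `t` modulo `N` and to `s` modulo `p`. Squarefreeness is what makes `p` prime to `N`.
sqrt-mod-product : ∀ a ps → All Prime ps → Squarefree (+ product ps) →
  (∀ {p} → Prime p → + p ∣ + product ps → IsSquareMod (+ p) a) →
  IsSquareMod (+ product ps) a
sqrt-mod-product a [] _ _ _ = 0ℤ , ∣ᵤ⇒∣ (ℕᵈ.1∣ _)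
sqrt-mod-product a (p ∷ ps) (pp ∷ pps) sf loc =
  t + N * w , ≡.subst (_∣ (t + N * w) * (t + N * w) - a) (≡.sym (ℤ.pos-* p (product ps)))
    (coprime-* (≡.subst (N ∣_) (lem₁ t N w a) (∣m∣n⇒∣m+n t-sq (∣m⇒∣m*n _ ∣-refl)))
      (≡.subst (+ p ∣_) (lem₂ t N w y s a)
        (∣m∣n⇒∣m+n (∣m⇒∣m*n ((s - t) * (t + N * w + s)) Ny) s-sq)))
  where
  N = + product ps
  pN : + product (p ∷ ps) ≡ + p * N
  pN = ℤ.pos-* p (product ps)
  up : ∀ {d} → d ∣ N → d ∣ + product (p ∷ ps)
  up h = ≡.subst (_ ∣_) (≡.sym pN) (∣n⇒∣m*n (+ p) h)
  p∤N : ¬ + p ∣ N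
  p∤N h = sf pp (≡.subst (+ p * + p ∣_) (≡.sym pN) (*-monoʳ-∣ (+ p) h))
  rec = sqrt-mod-product a ps pps (λ q h → sf q (up h)) (λ q h → loc q (up h))
  t = proj₁ rec
  t-sq = proj₂ rec
  s = proj₁ (loc pp (≡.subst (+ p ∣_) (≡.sym pN) (∣m⇒∣m*n N ∣-refl)))
  s-sq = proj₂ (loc pp (≡.subst (+ p ∣_) (≡.sym pN) (∣m⇒∣m*n N ∣-refl)))
  y = proj₁ (inverse-mod pp p∤N)
  Ny = proj₂ (inverse-mod pp p∤N)
  w = y * (s - t)
  lem₁ : ∀ t N w a → t * t - a + N * (w * (t + t + N * w)) ≡ (t + N * w) * (t + N * w) - a
  lem₁ = solve-∀
  lem₂ : ∀ t N w y s a → (N * y - 1ℤ) * ((s - t) * (t + N * (y * (s - t)) + s)) + (s * s - a) ≡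
         (t + N * (y * (s - t))) * (t + N * (y * (s - t))) - a
  lem₂ = solve-∀
  coprime-* : ∀ {x} → N ∣ x → + p ∣ x → + p * N ∣ x
  coprime-* (divides q ≡.refl) h with euclid pp q N h
  ... | inj₁ d = *-monoˡ-∣ N d
  ... | inj₂ d = contradiction d p∤N

-- Squares modulo 4 and 8

prime-2 : Prime 2
prime-2 = from-yes (prime? 2)

parity : ∀ x → + 2 ∣ x ⊎ + 2 ∣ x - 1ℤ
parity x with x %ℕ 2 | a≡a%ℕn+[a/ℕn]*n x 2 | n%ℕd<d x 2
... | 0 | e | _ = inj₁ (divides (x /ℕ 2) (≡.trans e (ℤ.+-identityˡ _)))
... | 1 | e | _ = inj₂ (divides (x /ℕ 2) (≡.trans (≡.cong (_- 1ℤ) e) (lem (x /ℕ 2 * + 2))))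
  where
  lem : ∀ e → 1ℤ + e - 1ℤ ≡ e
  lem = solve-∀
... | suc (suc _) | _ | s≤s (s≤s ())

odd-square : ∀ {x} → + 2 ∣ x - 1ℤ → + 8 ∣ x * x - 1ℤ
odd-square {x} (divides q e) with parity q
... | inj₁ (divides r ≡.refl) = divides (r * (r * + 2 + 1ℤ)) (begin
  x * x - 1ℤ             ≡⟨ lem₁ x ⟩
  (x - 1ℤ) * (x - 1ℤ + + 2) ≡⟨ ≡.cong (λ y → y * (y + + 2)) e ⟩
  r * + 2 * + 2 * (r * + 2 * + 2 + + 2) ≡⟨ lem₂ r ⟩
  r * (r * + 2 + 1ℤ) * + 8 ∎)
  where
  open ≡-Reasoning
  lem₁ : ∀ x → x * x - 1ℤ ≡ (x - 1ℤ) * (x - 1ℤ + + 2)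
  lem₁ = solve-∀
  lem₂ : ∀ r → r * + 2 * + 2 * (r * + 2 * + 2 + + 2) ≡ r * (r * + 2 + 1ℤ) * + 8
  lem₂ = solve-∀
... | inj₂ (divides r f) = divides ((r * + 2 + 1ℤ) * (r + 1ℤ)) (begin
  x * x - 1ℤ             ≡⟨ lem₁ x ⟩
  (x - 1ℤ) * (x - 1ℤ + + 2) ≡⟨ ≡.cong (λ y → y * (y + + 2)) e ⟩
  q * + 2 * (q * + 2 + + 2) ≡⟨ lem₂ q ⟩
  (q - 1ℤ + 1ℤ) * (q - 1ℤ + + 2) * + 4 ≡⟨ ≡.cong (λ y → (y + 1ℤ) * (y + + 2) * + 4) f ⟩
  (r * + 2 + 1ℤ) * (r * + 2 + + 2) * + 4 ≡⟨ lem₃ r ⟩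
  (r * + 2 + 1ℤ) * (r + 1ℤ) * + 8 ∎)
  where
  open ≡-Reasoning
  lem₁ : ∀ x → x * x - 1ℤ ≡ (x - 1ℤ) * (x - 1ℤ + + 2)
  lem₁ = solve-∀
  lem₂ : ∀ q → q * + 2 * (q * + 2 + + 2) ≡ (q - 1ℤ + 1ℤ) * (q - 1ℤ + + 2) * + 4
  lem₂ = solve-∀
  lem₃ : ∀ r → (r * + 2 + 1ℤ) * (r * + 2 + + 2) * + 4 ≡ (r * + 2 + 1ℤ) * (r + 1ℤ) * + 8
  lem₃ = solve-∀

even-square : ∀ {x} → + 2 ∣ x → + 4 ∣ x * x
even-square (divides q ≡.refl) = divides (q * q) (lem q)
  where
  lem : ∀ q → q * + 2 * (q * + 2) ≡ q * q * + 4
  lem = solve-∀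

square-mod-4 : ∀ x → + 2 ∣ x × + 4 ∣ x * x - 0ℤ ⊎ + 4 ∣ x * x - 1ℤ
square-mod-4 x with parity x
... | inj₁ h = inj₁ (h , ≡.subst (+ 4 ∣_) (≡.sym (ℤ.+-identityʳ _)) (even-square h))
... | inj₂ h = inj₂ (∣-trans (divides (+ 2) ≡.refl) (odd-square {x} h))

-- The term `4w` is invisible modulo 4. It is there for the rank 2 case in which -αγ is a square,
-- where `w` is -βγ.
three-squares-mod-4 : ∀ w v → + 4 ∣ diag (1ℤ , 1ℤ , 1ℤ + + 4 * w) v → + 2 ∣³ v
three-squares-mod-4 w (x , y , z) h = go (square-mod-4 x) (square-mod-4 y) (square-mod-4 z)
  where
  lem : ∀ x y z r s t w → 1ℤ * (x * x) + 1ℤ * (y * y) + (1ℤ + + 4 * w) * (z * z) -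
    ((x * x - r) + (y * y - s) + (z * z - t) + w * (z * z) * + 4) ≡ r + s + t
  lem = solve-∀
  residue : ∀ r s t → + 4 ∣ x * x - r → + 4 ∣ y * y - s → + 4 ∣ z * z - t → + 4 ∣ r + s + t
  residue r s t p q u = ≡.subst (+ 4 ∣_) (lem x y z r s t w)
    (∣m∣n⇒∣m-n h (∣m∣n⇒∣m+n (∣m∣n⇒∣m+n (∣m∣n⇒∣m+n p q) u) (divides (w * (z * z)) ≡.refl)))
  go : (+ 2 ∣ x × + 4 ∣ x * x - 0ℤ ⊎ + 4 ∣ x * x - 1ℤ) →
       (+ 2 ∣ y × + 4 ∣ y * y - 0ℤ ⊎ + 4 ∣ y * y - 1ℤ) →
       (+ 2 ∣ z × + 4 ∣ z * z - 0ℤ ⊎ + 4 ∣ z * z - 1ℤ) → + 2 ∣³ (x , y , z)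
  go (inj₁ (p , _)) (inj₁ (q , _)) (inj₁ (r , _)) = p , q , r
  go (inj₂ p) (inj₁ (_ , q)) (inj₁ (_ , r)) =
    contradiction (residue 1ℤ 0ℤ 0ℤ p q r) (from-no (+ 4 ∣? + 1))
  go (inj₁ (_ , p)) (inj₂ q) (inj₁ (_ , r)) =
    contradiction (residue 0ℤ 1ℤ 0ℤ p q r) (from-no (+ 4 ∣? + 1))
  go (inj₁ (_ , p)) (inj₁ (_ , q)) (inj₂ r) =
    contradiction (residue 0ℤ 0ℤ 1ℤ p q r) (from-no (+ 4 ∣? + 1))
  go (inj₂ p) (inj₂ q) (inj₁ (_ , r)) =
    contradiction (residue 1ℤ 1ℤ 0ℤ p q r) (from-no (+ 4 ∣? + 2))
  go (inj₂ p) (inj₁ (_ , q)) (inj₂ r) =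
    contradiction (residue 1ℤ 0ℤ 1ℤ p q r) (from-no (+ 4 ∣? + 2))
  go (inj₁ (_ , p)) (inj₂ q) (inj₂ r) =
    contradiction (residue 0ℤ 1ℤ 1ℤ p q r) (from-no (+ 4 ∣? + 2))
  go (inj₂ p) (inj₂ q) (inj₂ r) =
    contradiction (residue 1ℤ 1ℤ 1ℤ p q r) (from-no (+ 4 ∣? + 3))

three-squares-anisotropic : ∀ w → ¬ IsotropicAt 2 (1ℤ , 1ℤ , 1ℤ + + 4 * w)
three-squares-anisotropic w h =
  let v , d , n = primitive-solution prime-2 (1ℤ , 1ℤ , 1ℤ + + 4 * w) h 2 in n (three-squares-mod-4 w v d)

-- Square roots of a obtained from local zeros of z² - a x² - b y²

sqrt-mod-squarefree : ∀ a {b} → b ≢ 0ℤ → Squarefree b →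
  (∀ {p} → Prime p → + p ∣ b → IsSquareMod (+ p) a) → IsSquareMod b a
sqrt-mod-squarefree a {b} b≢0 sf loc = go (factorise ℤ.∣ b ∣ ⦃ ℤ.≢-nonZero b≢0 ⦄)
  where
  go : PrimeFactorisation ℤ.∣ b ∣ → IsSquareMod b a
  go record { factors = ps ; isFactorisation = e ; factorsPrime = pps } =
    let t , h = sqrt-mod-product a ps pps
                  (λ pp d → sf pp (∣-trans d N∣b)) (λ pp d → loc pp (∣-trans d N∣b)) in
    t , ∣-trans m∣∣m∣ (≡.subst (λ n → + n ∣ t * t - a) (≡.sym e) h)
    where
    N∣b : + product ps ∣ b
    N∣b = ≡.subst (λ n → + n ∣ b) e ∣m∣∣m

small-sqrt-mod : ∀ {a b} → b ≢ 0ℤ → IsSquareMod b a →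
                 ∃[ t ] b ∣ t * t - a × 2 ℕ.* ℤ.∣ t ∣ ℕ.≤ ℤ.∣ b ∣
small-sqrt-mod {a} {b} b≢0 (t , h) = go (ℕ.≤-total (2 ℕ.* r) n)
  where
  instance _ = ℤ.≢-nonZero b≢0
  n = ℤ.∣ b ∣
  r = t %ℕ n
  q = t /ℕ n
  r≤n : r ℕ.≤ n
  r≤n = ℕ.<⇒≤ (n%ℕd<d t n)
  shift : ∀ u w → u ≡ t - w * + n → b ∣ u * u - a
  shift u w ≡.refl = ≡.subst (b ∣_) (lem t w (+ n) a)
    (∣m∣n⇒∣m-n h (∣m⇒∣m*n (w * (t + t - w * + n)) m∣∣m∣))
    where
    lem : ∀ t w n a → t * t - a - n * (w * (t + t - w * n)) ≡ (t - w * n) * (t - w * n) - a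
    lem = solve-∀
  e : + r ≡ t - q * + n
  e = ≡.trans (lem (+ r) (q * + n)) (≡.cong (_- q * + n) (≡.sym (a≡a%ℕn+[a/ℕn]*n t n)))
    where
    lem : ∀ r s → r ≡ r + s - s
    lem = solve-∀
  go : 2 ℕ.* r ℕ.≤ n ⊎ n ℕ.≤ 2 ℕ.* r → ∃[ t ] b ∣ t * t - a × 2 ℕ.* ℤ.∣ t ∣ ℕ.≤ n
  go (inj₁ 2r≤n) = + r , shift (+ r) q e , 2r≤n
  go (inj₂ n≤2r) = - + (n ℕ.∸ r) , shift (- + (n ℕ.∸ r)) (q + 1ℤ) e′ ,
    ≡.subst (λ m → 2 ℕ.* m ℕ.≤ n) (≡.sym (ℤ.∣-i∣≡∣i∣ (+ (n ℕ.∸ r)))) bound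
    where
    e′ : - + (n ℕ.∸ r) ≡ t - (q + 1ℤ) * + n
    e′ = begin
      - + (n ℕ.∸ r)     ≡⟨ ≡.cong -_ (≡.trans (≡.sym (ℤ.⊖-≥ r≤n)) (≡.sym (ℤ.m-n≡m⊖n n r))) ⟩
      - (+ n - + r)     ≡⟨ ≡.cong (λ x → - (+ n - x)) e ⟩
      - (+ n - (t - q * + n)) ≡⟨ lem (+ n) t q ⟩
      t - (q + 1ℤ) * + n ∎
      where
      open ≡-Reasoning
      lem : ∀ n t q → - (n - (t - q * n)) ≡ t - (q + 1ℤ) * n
      lem = solve-∀
    bound : 2 ℕ.* (n ℕ.∸ r) ℕ.≤ n
    bound = begin
      2 ℕ.* (n ℕ.∸ r)       ≡⟨ ℕ.*-distribˡ-∸ 2 n r ⟩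
      2 ℕ.* n ℕ.∸ 2 ℕ.* r   ≤⟨ ℕ.∸-monoʳ-≤ (2 ℕ.* n) n≤2r ⟩
      2 ℕ.* n ℕ.∸ n         ≡⟨ ≡.cong (ℕ._∸ n) (≡.cong (n ℕ.+_) (ℕ.+-identityʳ n)) ⟩
      n ℕ.+ n ℕ.∸ n         ≡⟨ ℕ.m+n∸n≡m n n ⟩
      n                     ∎
      where open ℕ.≤-Reasoning

-- diag (normal a b) (x , y , z) = z² − a x² − b y².
normal : ℤ → ℤ → ℤ³
normal a b = - a , - b , 1ℤ

square-divides : ∀ p {u} → p ∣ u → p * p ∣ u * u
square-divides p (divides q ≡.refl) = divides (q * q) (lem q p)
  where
  lem : ∀ q p → q * p * (q * p) ≡ q * q * (p * p)
  lem = solve-∀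

module _ a b P (x y z : ℤ) (h : P * P ∣ diag (normal a (b * P)) (x , y , z)) where

  divides-norm : P ∣ z * z - a * (x * x)
  divides-norm = ≡.subst (P ∣_) (lem a b P x y z)
    (∣m∣n⇒∣m+n (∣-trans (∣m⇒∣m*n P ∣-refl) h) (divides (b * (y * y)) ≡.refl))
    where
    lem : ∀ a b p x y z → - a * (x * x) + - (b * p) * (y * y) + 1ℤ * (z * z) + b * (y * y) * p ≡
          z * z - a * (x * x)
    lem = solve-∀

  -- The term `b P y²` carries just one explicit factor `P`. Once `P` divides `x`, and with it `z`,
  -- the other two terms vanish modulo `P²` and force `P` into `b y²`. This is why zeros are taken
  -- modulo `P²` and not only modulo `P`.
  divides-all : .⦃ ℤ.NonZero P ⦄ → (∀ u v → P ∣ u * v → P ∣ u ⊎ P ∣ v) → ¬ P ∣ b →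
                P ∣ x → P ∣³ (x , y , z)
  divides-all prime P∤b P∣x = P∣x , P∣y , P∣z
    where
    square : ∀ u → P ∣ u * u → P ∣ u
    square u h = [ id , id ]′ (prime u u h)
    lem : ∀ a b p x y z → z * z - a * (x * x) -
          (- a * (x * x) + - (b * p) * (y * y) + 1ℤ * (z * z)) ≡ p * (b * (y * y))
    lem = solve-∀
    P∣z : P ∣ z
    P∣z = square z (∣-diff {x = z * z} (a * (x * x)) divides-norm (∣n⇒∣m*n a (∣m⇒∣m*n x P∣x)))
    P∣byy : P ∣ b * (y * y)
    P∣byy = *-cancelˡ-∣ P {P} {b * (y * y)} (≡.subst (P * P ∣_) (lem a b P x y z)
      (∣m∣n⇒∣m-n {n = diag (normal a (b * P)) (x , y , z)} (∣m∣n⇒∣m-n (square-divides P P∣z)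
        (∣n⇒∣m*n a (square-divides P P∣x))) h))
    P∣y : P ∣ y
    P∣y = [ (λ d → contradiction d P∤b) , square y ]′ (prime b (y * y) P∣byy)

-- In a primitive zero modulo `p²` the coordinate `x` is prime to `p` by `divides-all`, so z/x is a
-- square root of `a` modulo `p`.
isotropicAt⇒square-mod : ∀ {p} → Prime p → ∀ a b → ¬ + p ∣ b →
                         IsotropicAt p (normal a (b * + p)) → IsSquareMod (+ p) a
isotropicAt⇒square-mod {p} pp a b p∤b iso
  with (x , y , z) , h , p∤v ← primitive-solution pp (normal a (b * + p)) iso 2
  with + p ∣? x | ≡.subst (_∣ diag (normal a (b * + p)) (x , y , z)) p^2 h
  where
  p^2 : + (p ℕ.^ 2) ≡ + p * + p
  p^2 = ≡.trans (pos-^-suc p 1) (≡.cong (λ e → + p * + e) (ℕ.*-identityʳ p))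
... | no p∤x  | h′ = sqrt-mod-prime pp a {x} {z} p∤x (divides-norm a b (+ p) x y z h′)
... | yes p∣x | h′ = ⊥-elim (p∤v
  (divides-all a b (+ p) x y z h′ ⦃ prime⇒nonZero pp ⦄ (euclid pp) p∤b p∣x))

isotropic⇒square-mod : ∀ a {b} → Squarefree b → LocallyIsotropic (normal a b) →
                       ∀ {p} → Prime p → + p ∣ b → IsSquareMod (+ p) a
isotropic⇒square-mod a sf loc {p} pp (divides b ≡.refl) =
  isotropicAt⇒square-mod pp a b (λ d → sf pp (*-monoˡ-∣ (+ p) d)) (loc pp)

reduced-square-root : ∀ a {b} → b ≢ 0ℤ → Squarefree b → LocallyIsotropic (normal a b) →
                      ∃[ t ] b ∣ t * t - a × 2 ℕ.* ℤ.∣ t ∣ ℕ.≤ ℤ.∣ b ∣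
reduced-square-root a b≢0 sf loc =
  small-sqrt-mod b≢0 (sqrt-mod-squarefree a b≢0 sf (isotropic⇒square-mod a sf loc))

-- The Hasse principle for diagonal ternary forms

-- Multiplication by t + √a in ℤ[√a], whose norm is t² − a = b b′.
norm-transfer : ∀ a {b b′} t → b ≢ 0ℤ → b′ ≢ 0ℤ → t * t - a ≡ b * b′ →
                Transfer (normal a b) (normal a b′)
norm-transfer a {b} {b′} t b≢0 b′≢0 e = record
  { map      = λ { (x , y , z) → z + t * x , b * y , z * t + a * x }
  ; factor   = b * b′
  ; det      = b * b′
  ; det≢0    = *-≢0 b≢0 b′≢0
  ; diag-map = λ { (x , y , z) → begin
      - a * ((z + t * x) * (z + t * x)) + - b′ * (b * y * (b * y)) + 1ℤ * ((z * t + a * x) * (z * t + a * x))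
        ≡⟨ lem₁ a b b′ t x y z ⟩
      (t * t - a) * (z * z - a * (x * x)) - b * b′ * (b * (y * y))
        ≡⟨ ≡.cong (λ n → n * (z * z - a * (x * x)) - b * b′ * (b * (y * y))) e ⟩
      b * b′ * (z * z - a * (x * x)) - b * b′ * (b * (y * y))
        ≡⟨ lem₂ a b b′ x y z ⟩
      b * b′ * (- a * (x * x) + - b * (y * y) + 1ℤ * (z * z)) ∎ }
  ; reflects = λ { d (x , y , z) (dx , dy , dz) →
      ≡.subst (d ∣_) (≡.trans (lem₃ a t x z) (≡.cong (_* x) e)) (∣m∣n⇒∣m-n (∣n⇒∣m*n t dx) dz) ,
      ≡.subst (d ∣_) (lem₄ b b′ y) (∣n⇒∣m*n b′ dy) ,
      ≡.subst (d ∣_) (≡.trans (lem₅ a t x z) (≡.cong (_* z) e)) (∣m∣n⇒∣m-n (∣n⇒∣m*n t dz) (∣n⇒∣m*n a dx)) }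
  }
  where
  open ≡-Reasoning
  lem₁ : ∀ a b b′ t x y z →
    - a * ((z + t * x) * (z + t * x)) + - b′ * (b * y * (b * y)) + 1ℤ * ((z * t + a * x) * (z * t + a * x)) ≡
    (t * t - a) * (z * z - a * (x * x)) - b * b′ * (b * (y * y))
  lem₁ = solve-∀
  lem₂ : ∀ a b b′ x y z → b * b′ * (z * z - a * (x * x)) - b * b′ * (b * (y * y)) ≡
    b * b′ * (- a * (x * x) + - b * (y * y) + 1ℤ * (z * z))
  lem₂ = solve-∀
  lem₃ : ∀ a t x z → t * (z + t * x) - (z * t + a * x) ≡ (t * t - a) * x
  lem₃ = solve-∀
  lem₄ : ∀ b b′ y → b′ * (b * y) ≡ b * b′ * y
  lem₄ = solve-∀
  lem₅ : ∀ a t x z → t * (z * t + a * x) - a * (z + t * x) ≡ (t * t - a) * z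
  lem₅ = solve-∀

swap-transfer : ∀ a b c → Transfer (a , b , c) (b , a , c)
swap-transfer a b c = record
  { map      = λ { (x , y , z) → y , x , z }
  ; factor   = 1ℤ
  ; det      = 1ℤ
  ; det≢0    = λ ()
  ; diag-map = λ { (x , y , z) → lem a b c x y z }
  ; reflects = λ { d (x , y , z) (dx , dy , dz) → ∣n⇒∣m*n 1ℤ dy , ∣n⇒∣m*n 1ℤ dx , ∣n⇒∣m*n 1ℤ dz }
  }
  where
  lem : ∀ a b c x y z → b * (y * y) + a * (x * x) + c * (z * z) ≡
        1ℤ * (a * (x * x) + b * (y * y) + c * (z * z))
  lem = solve-∀

remove-square : ∀ a b {s} → s ≢ 0ℤ → Transfer (normal a (b * (s * s))) (normal a b)
remove-square a b {s} s≢0 = record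
  { map      = λ { (x , y , z) → x , s * y , z }
  ; factor   = 1ℤ
  ; det      = s
  ; det≢0    = s≢0
  ; diag-map = λ { (x , y , z) → lem a b s x y z }
  ; reflects = λ { d (x , y , z) (dx , dy , dz) → ∣n⇒∣m*n s dx , dy , ∣n⇒∣m*n s dz }
  }
  where
  lem : ∀ a b s x y z → - a * (x * x) + - b * (s * y * (s * y)) + 1ℤ * (z * z) ≡
        1ℤ * (- a * (x * x) + - (b * (s * s)) * (y * y) + 1ℤ * (z * z))
  lem = solve-∀

-- The rational inverse of `remove-square`, multiplied by `s` to make it integral.
insert-square : ∀ a b {s} → s ≢ 0ℤ → Transfer (normal a b) (normal a (b * (s * s)))
insert-square a b {s} s≢0 = record
  { map      = λ { (x , y , z) → s * x , y , s * z }
  ; factor   = s * s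
  ; det      = s
  ; det≢0    = s≢0
  ; diag-map = λ { (x , y , z) → lem a b s x y z }
  ; reflects = λ { d (x , y , z) (dx , dy , dz) → dx , ∣n⇒∣m*n s dy , dz }
  }
  where
  lem : ∀ a b s x y z → - a * (s * x * (s * x)) + - (b * (s * s)) * (y * y) + 1ℤ * (s * z * (s * z)) ≡
        s * s * (- a * (x * x) + - b * (y * y) + 1ℤ * (z * z))
  lem = solve-∀

-- Multiplying the form by `c` completes the last term to the square (cz)².
to-normal : ∀ a b {c} → c ≢ 0ℤ → Transfer (a , b , c) (normal (- (a * c)) (- (b * c)))
to-normal a b {c} c≢0 = record
  { map      = λ { (x , y , z) → x , y , c * z }
  ; factor   = c
  ; det      = c
  ; det≢0    = c≢0
  ; diag-map = λ { (x , y , z) → lem a b c x y z }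
  ; reflects = λ { d (x , y , z) (dx , dy , dz) → ∣n⇒∣m*n c dx , ∣n⇒∣m*n c dy , dz }
  }
  where
  lem : ∀ a b c x y z → - - (a * c) * (x * x) + - - (b * c) * (y * y) + 1ℤ * (c * z * (c * z)) ≡
        c * (a * (x * x) + b * (y * y) + c * (z * z))
  lem = solve-∀

from-normal : ∀ a b {c} → c ≢ 0ℤ → Transfer (normal (- (a * c)) (- (b * c))) (a , b , c)
from-normal a b {c} c≢0 = record
  { map      = λ { (x , y , z) → c * x , c * y , z }
  ; factor   = c
  ; det      = c
  ; det≢0    = c≢0
  ; diag-map = λ { (x , y , z) → lem a b c x y z }
  ; reflects = λ { d (x , y , z) (dx , dy , dz) → dx , dy , ∣n⇒∣m*n c dz }
  }
  where
  lem : ∀ a b c x y z → a * (c * x * (c * x)) + b * (c * y * (c * y)) + c * (z * z) ≡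
        c * (- - (a * c) * (x * x) + - - (b * c) * (y * y) + 1ℤ * (z * z))
  lem = solve-∀

-- The hypotheses give `b′ ≤ b/4 + 1`, which is below `b` from `b = 2` on. In integers: `b′ ≥ b`
-- would imply 4b² ≤ b² + 4b, but 4b < 6b ≤ 3b².
descent-bound : ∀ {t a b b′} → 2 ℕ.* t ℕ.≤ b → a ℕ.≤ b → b ℕ.* b′ ℕ.≤ t ℕ.* t ℕ.+ a →
                2 ℕ.≤ b → b′ ℕ.< b
descent-bound {t} {a} {b} {b′} 2t≤b a≤b bb′≤ 2≤b with b′ ℕ.<? b
... | yes b′<b = b′<b
... | no b′≮b = contradiction 4bb≤ (ℕ.<⇒≱ <4bb)
  where
  open ℕ.≤-Reasoning
  instance _ = ℕ.>-nonZero (ℕ.≤-trans (s≤s z≤n) 2≤b)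
  4bb≤ : 4 ℕ.* (b ℕ.* b) ℕ.≤ b ℕ.* b ℕ.+ 4 ℕ.* b
  4bb≤ = begin
    4 ℕ.* (b ℕ.* b)               ≤⟨ ℕ.*-monoʳ-≤ 4 (ℕ.*-monoʳ-≤ b (ℕ.≮⇒≥ b′≮b)) ⟩
    4 ℕ.* (b ℕ.* b′)              ≤⟨ ℕ.*-monoʳ-≤ 4 bb′≤ ⟩
    4 ℕ.* (t ℕ.* t ℕ.+ a)         ≡⟨ ℕ.*-distribˡ-+ 4 (t ℕ.* t) a ⟩
    4 ℕ.* (t ℕ.* t) ℕ.+ 4 ℕ.* a   ≡⟨ ≡.cong (ℕ._+ 4 ℕ.* a) (ℕ.[m*n]*[o*p]≡[m*o]*[n*p] 2 2 t t) ⟩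
    2 ℕ.* t ℕ.* (2 ℕ.* t) ℕ.+ 4 ℕ.* a ≤⟨ ℕ.+-mono-≤ (ℕ.*-mono-≤ 2t≤b 2t≤b) (ℕ.*-monoʳ-≤ 4 a≤b) ⟩
    b ℕ.* b ℕ.+ 4 ℕ.* b           ∎
  <4bb : b ℕ.* b ℕ.+ 4 ℕ.* b ℕ.< 4 ℕ.* (b ℕ.* b)
  <4bb = ℕ.+-monoʳ-< (b ℕ.* b) (begin-strict
    4 ℕ.* b           <⟨ ℕ.*-monoˡ-< b {4} {6} (s≤s (s≤s (s≤s (s≤s (s≤s z≤n))))) ⟩
    6 ℕ.* b           ≡⟨ ℕ.*-assoc 3 2 b ⟩
    3 ℕ.* (2 ℕ.* b)   ≤⟨ ℕ.*-monoʳ-≤ 3 (ℕ.*-monoˡ-≤ b 2≤b) ⟩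
    3 ℕ.* (b ℕ.* b)   ∎)

-- Descent on the coefficients

module Legendre (em : ExcludedMiddle 0ℓ) where
  open Classical em

  Solvable : ℤ → ℤ → Set
  Solvable a b = a ≢ 0ℤ → b ≢ 0ℤ → Squarefree a → Squarefree b →
                 LocallyIsotropic (normal a b) → Isotropic (normal a b)

  unit-coefficients : ∀ a b → ℤ.∣ a ∣ ℕ.≤ 1 → ℤ.∣ b ∣ ℕ.≤ 1 → Solvable a b
  unit-coefficients (+ 0) b _ _ a≢0 = contradiction ≡.refl a≢0
  unit-coefficients a (+ 0) _ _ _ b≢0 = contradiction ≡.refl b≢0
  unit-coefficients (+ 1) b _ _ _ _ _ _ _ = (1ℤ , 0ℤ , 1ℤ) , lem b , from-no (0ℤ ∣³? (1ℤ , 0ℤ , 1ℤ))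
    where
    lem : ∀ b → -1ℤ * (1ℤ * 1ℤ) + - b * (0ℤ * 0ℤ) + 1ℤ * (1ℤ * 1ℤ) ≡ 0ℤ
    lem = solve-∀
  unit-coefficients a (+ 1) _ _ _ _ _ _ _ = (0ℤ , 1ℤ , 1ℤ) , lem a , from-no (0ℤ ∣³? (0ℤ , 1ℤ , 1ℤ))
    where
    lem : ∀ a → - a * (0ℤ * 0ℤ) + -1ℤ * (1ℤ * 1ℤ) + 1ℤ * (1ℤ * 1ℤ) ≡ 0ℤ
    lem = solve-∀
  unit-coefficients -[1+ 0 ] -[1+ 0 ] _ _ _ _ _ _ loc =
    contradiction (loc prime-2) (three-squares-anisotropic 0ℤ)
  unit-coefficients (+ suc (suc _)) b (s≤s ()) _
  unit-coefficients -[1+ suc _ ] b (s≤s ()) _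
  unit-coefficients a (+ suc (suc _)) _ (s≤s ())
  unit-coefficients a -[1+ suc _ ] _ (s≤s ())

  -- Since `t² − a = b b′` is a norm from ℤ[√a], the coefficient `b` may be traded for `b′`, and
  -- then for the squarefree part of `b′`. Local zeros are carried down to the smaller form, and its
  -- global zero is carried back up.
  descent-step : ∀ a b → (∀ b′ → ℤ.∣ b′ ∣ ℕ.< ℤ.∣ b ∣ → Solvable a b′) →
                 ℤ.∣ a ∣ ℕ.≤ ℤ.∣ b ∣ → Solvable a b
  descent-step a b rec a≤b a≢0 b≢0 sfa sfb loc with ℤ.∣ b ∣ ℕ.≤? 1
  ... | yes b≤1 = unit-coefficients a b (ℕ.≤-trans a≤b b≤1) b≤1 a≢0 b≢0 sfa sfb loc
  ... | no b≰1 with reduced-square-root a b≢0 sfb loc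
  ...   | t , divides b′ e , 2t≤b with b′ ℤ.≟ 0ℤ
  -- Here a = t², which gives a zero outright.
  ...     | yes ≡.refl = (1ℤ , 0ℤ , t) , ≡.trans (lem a b t) e , λ h →
              contradiction (0∣⇒≡0 (proj₁ h)) λ ()
    where
    lem : ∀ a b t → - a * (1ℤ * 1ℤ) + - b * (0ℤ * 0ℤ) + 1ℤ * (t * t) ≡ t * t - a
    lem = solve-∀
  ...     | no b′≢0 =
    let b₀ , s , eq , s≢0 , sf₀ , b₀≤b′ = squarefree-decomposition b′ b′≢0
        b₀≢0 = λ b₀≡0 → b′≢0 (≡.trans eq (≡.cong (_* (s * s)) b₀≡0))
        loc′ = λ {l} (pl : Prime l) → transfer-isotropicAt (remove-square a b₀ s≢0) pl
                 (≡.subst (λ c → IsotropicAt l (normal a c)) eq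
                   (transfer-isotropicAt (norm-transfer a t b≢0 b′≢0 e₁) pl (loc pl)))
        sol = rec b₀ (ℕ.≤-<-trans b₀≤b′ b′<b) a≢0 b₀≢0 sfa sf₀ loc′
    -- The relation t² - a = b b′ is symmetric in `b` and `b′`, so the same construction leads back.
    in transfer-isotropic (norm-transfer a t b′≢0 b≢0 e)
         (≡.subst (λ c → Isotropic (normal a c)) (≡.sym eq)
           (transfer-isotropic (insert-square a b₀ s≢0) sol))
    where
    e₁ : t * t - a ≡ b * b′
    e₁ = ≡.trans e (ℤ.*-comm b′ b)
    b′<b : ℤ.∣ b′ ∣ ℕ.< ℤ.∣ b ∣
    b′<b = descent-bound {ℤ.∣ t ∣} 2t≤b a≤b bound (ℕ.≰⇒> b≰1)
      where
      open ℕ.≤-Reasoning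
      bound : ℤ.∣ b ∣ ℕ.* ℤ.∣ b′ ∣ ℕ.≤ ℤ.∣ t ∣ ℕ.* ℤ.∣ t ∣ ℕ.+ ℤ.∣ a ∣
      bound = begin
        ℤ.∣ b ∣ ℕ.* ℤ.∣ b′ ∣          ≡⟨ ℤ.abs-* b b′ ⟨
        ℤ.∣ b * b′ ∣                  ≡⟨ ≡.cong ℤ.∣_∣ e₁ ⟨
        ℤ.∣ t * t - a ∣               ≤⟨ ℤ.∣i-j∣≤∣i∣+∣j∣ (t * t) a ⟩
        ℤ.∣ t * t ∣ ℕ.+ ℤ.∣ a ∣       ≡⟨ ≡.cong (ℕ._+ ℤ.∣ a ∣) (ℤ.abs-* t t) ⟩
        ℤ.∣ t ∣ ℕ.* ℤ.∣ t ∣ ℕ.+ ℤ.∣ a ∣ ∎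

  squarefree-solvable : ∀ a b → Solvable a b
  squarefree-solvable a b = <-rec
    (λ n → ∀ a b → ℤ.∣ a ∣ ℕ.+ ℤ.∣ b ∣ ≡ n → Solvable a b) step _ a b ≡.refl
    where
    step : ∀ n → (∀ {m} → m ℕ.< n → ∀ a b → ℤ.∣ a ∣ ℕ.+ ℤ.∣ b ∣ ≡ m → Solvable a b) →
           ∀ a b → ℤ.∣ a ∣ ℕ.+ ℤ.∣ b ∣ ≡ n → Solvable a b
    step n rec a b ≡.refl with ℕ.≤-total ℤ.∣ a ∣ ℤ.∣ b ∣
    ... | inj₁ a≤b = descent-step a b
      (λ b′ b′<b → rec (ℕ.+-monoʳ-< ℤ.∣ a ∣ b′<b) a b′ ≡.refl) a≤b
    ... | inj₂ b≤a = λ a≢0 b≢0 sfa sfb loc → transfer-isotropic (swap-transfer (- b) (- a) 1ℤ)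
      (descent-step b a
        (λ a′ a′<a → rec (≡.subst (ℤ.∣ b ∣ ℕ.+ ℤ.∣ a′ ∣ ℕ.<_) (ℕ.+-comm ℤ.∣ b ∣ ℤ.∣ a ∣)
          (ℕ.+-monoʳ-< ℤ.∣ b ∣ a′<a)) b a′ ≡.refl) b≤a b≢0 a≢0 sfb sfa
        (λ pl → transfer-isotropicAt (swap-transfer (- a) (- b) 1ℤ) pl (loc pl)))

  -- `remove-square` and `insert-square` act on the second coefficient, so the square part of `a` is
  -- handled between two swaps.
  normal-solvable : ∀ a b → a ≢ 0ℤ → b ≢ 0ℤ →
                    LocallyIsotropic (normal a b) → Isotropic (normal a b)
  normal-solvable a b a≢0 b≢0 loc
    with squarefree-decomposition a a≢0 | squarefree-decomposition b b≢0
  ... | a₀ , s , ≡.refl , s≢0 , sfa , _ | b₀ , u , ≡.refl , u≢0 , sfb , _ =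
    transfer-isotropic (insert-square a b₀ u≢0)
      (transfer-isotropic (swap-transfer (- b₀) (- a) 1ℤ)
        (transfer-isotropic (insert-square b₀ a₀ s≢0)
          (transfer-isotropic (swap-transfer (- a₀) (- b₀) 1ℤ)
            (squarefree-solvable a₀ b₀ (λ { ≡.refl → a≢0 ≡.refl }) (λ { ≡.refl → b≢0 ≡.refl }) sfa sfb
              (λ pl → transfer-isotropicAt (swap-transfer (- b₀) (- a₀) 1ℤ) pl
                (transfer-isotropicAt (remove-square b₀ a₀ s≢0) pl
                  (transfer-isotropicAt (swap-transfer (- a) (- b₀) 1ℤ) pl
                    (transfer-isotropicAt (remove-square a b₀ u≢0) pl (loc pl)))))))))

  locally-isotropic⇒isotropic : ∀ q → LocallyIsotropic q → Isotropic q
  locally-isotropic⇒isotropic (a , b , c) loc with a ℤ.≟ 0ℤ | b ℤ.≟ 0ℤ | c ℤ.≟ 0ℤ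
  ... | yes ≡.refl | _ | _ = (1ℤ , 0ℤ , 0ℤ) , lem b c , from-no (0ℤ ∣³? (1ℤ , 0ℤ , 0ℤ))
    where
    lem : ∀ b c → 0ℤ * (1ℤ * 1ℤ) + b * (0ℤ * 0ℤ) + c * (0ℤ * 0ℤ) ≡ 0ℤ
    lem = solve-∀
  ... | _ | yes ≡.refl | _ = (0ℤ , 1ℤ , 0ℤ) , lem a c , from-no (0ℤ ∣³? (0ℤ , 1ℤ , 0ℤ))
    where
    lem : ∀ a c → a * (0ℤ * 0ℤ) + 0ℤ * (1ℤ * 1ℤ) + c * (0ℤ * 0ℤ) ≡ 0ℤ
    lem = solve-∀
  ... | _ | _ | yes ≡.refl = (0ℤ , 0ℤ , 1ℤ) , lem a b , from-no (0ℤ ∣³? (0ℤ , 0ℤ , 1ℤ))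
    where
    lem : ∀ a b → a * (0ℤ * 0ℤ) + b * (0ℤ * 0ℤ) + 0ℤ * (1ℤ * 1ℤ) ≡ 0ℤ
    lem = solve-∀
  ... | no a≢0 | no b≢0 | no c≢0 = transfer-isotropic (from-normal a b c≢0)
    (normal-solvable _ _ (neg-≢0 (*-≢0 a≢0 c≢0)) (neg-≢0 (*-≢0 b≢0 c≢0))
      (λ pl → transfer-isotropicAt (to-normal a b c≢0) pl (loc pl)))
    where
    neg-≢0 : ∀ {x} → x ≢ 0ℤ → - x ≢ 0ℤ
    neg-≢0 {x} x≢0 e = x≢0 (ℤ.neg-injective e)

-- A criterion for squares

≡-residues : ∀ {n i j} → i ℕ.< n → j ℕ.< n → + n ∣ + i - + j → i ≡ j
≡-residues {n} {i} {j} i<n j<n h = [ (λ j≤i → ≡.sym (go j≤i i<n h)) , (λ i≤j → go i≤j j<n h′) ]′ (ℕ.≤-total j i)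
  where
  lem : ∀ a b → - (a - b) ≡ b - a
  lem = solve-∀
  h′ : + n ∣ + j - + i
  h′ = ≡.subst (+ n ∣_) (lem (+ i) (+ j)) (∣m⇒∣-m h)
  go : ∀ {i j} → i ℕ.≤ j → j ℕ.< n → + n ∣ + j - + i → i ≡ j
  go {i} {j} i≤j j<n d = ℕ.≤-antisym i≤j (ℕ.m∸n≡0⇒m≤n (diff≡0 (j ℕ.∸ i) (ℕ.≤-<-trans (ℕ.m∸n≤m j i) j<n)
    (∣⇒∣ᵤ (≡.subst (+ n ∣_) (≡.trans (ℤ.m-n≡m⊖n j i) (ℤ.⊖-≥ i≤j)) d))))
    where
    diff≡0 : ∀ m → m ℕ.< n → n ℕᵈ.∣ m → m ≡ 0
    diff≡0 zero _ _ = ≡.refl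
    diff≡0 (suc m) m<n n∣m = contradiction n∣m (ℕᵈ.>⇒∤ m<n)

%ℕ-injective : ∀ n .⦃ _ : ℕ.NonZero n ⦄ x y → x %ℕ n ≡ y %ℕ n → + n ∣ x - y
%ℕ-injective n x y e = divides (x /ℕ n - y /ℕ n) (begin
  x - y ≡⟨ ≡.cong₂ _-_ (a≡a%ℕn+[a/ℕn]*n x n) (a≡a%ℕn+[a/ℕn]*n y n) ⟩
  (+ (x %ℕ n) + x /ℕ n * + n) - (+ (y %ℕ n) + y /ℕ n * + n)
    ≡⟨ ≡.cong (λ r → (+ r + x /ℕ n * + n) - (+ (y %ℕ n) + y /ℕ n * + n)) e ⟩
  (+ (y %ℕ n) + x /ℕ n * + n) - (+ (y %ℕ n) + y /ℕ n * + n)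
    ≡⟨ lem (+ (y %ℕ n)) (x /ℕ n) (y /ℕ n) (+ n) ⟩
  (x /ℕ n - y /ℕ n) * + n ∎)
  where
  open ≡-Reasoning
  lem : ∀ r a b n → (r + a * n) - (r + b * n) ≡ (a - b) * n
  lem = solve-∀

-- If every residue had a square root s c modulo l, then s would be injective on
-- the l residues and moreover miss − s 1.
¬all-squares : ∀ {l} → Prime l → l ≢ 2 → ¬ (∀ c → IsSquareMod (+ l) c)
¬all-squares {l} pl l≢2 sqrt =
  collide (Fin.pigeonhole (ℕ.n<1+n l) (λ i → fromℕ< (n%ℕd<d (root i) l)))
  where
  instance _ = prime⇒nonZero pl
  s : ℕ → ℤ
  s c = proj₁ (sqrt (+ c))
  root : Fin (suc l) → ℤ
  root Fin.zero    = - s 1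
  root (Fin.suc i) = s (toℕ i)
  l∤1 : ¬ + l ∣ 1ℤ
  l∤1 h = contradiction (ℕᵈ.∣1⇒≡1 (∣⇒∣ᵤ h)) (ℕ.>⇒≢ (prime>1 pl))
  lem₁ : ∀ a b s t → (s - t) * (s + t) - (s * s - a) + (t * t - b) ≡ a - b
  lem₁ = solve-∀
  squares-agree : ∀ {t} a b → + l ∣ t * t - + a → + l ∣ t - s b → + l ∣ + a - + b
  squares-agree {t} a b h d = ≡.subst (+ l ∣_) (lem₁ (+ a) (+ b) t (s b))
    (∣m∣n⇒∣m+n (∣m∣n⇒∣m-n (∣m⇒∣m*n (t + s b) d) h) (proj₂ (sqrt (+ b))))
  neg-square : ∀ s a → s * s - a ≡ - s * - s - a
  neg-square = solve-∀
  double : ∀ s → - (- s - s) ≡ + 2 * s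
  double = solve-∀
  no-fixed : ¬ + l ∣ - s 1 - s 1
  no-fixed d = [ l∤2 , l∤s ]′ (euclid pl (+ 2) (s 1) (≡.subst (+ l ∣_) (double (s 1)) (∣m⇒∣-m d)))
    where
    l∤2 : ¬ + l ∣ + 2
    l∤2 h = l≢2 (ℕ.≤-antisym (ℕᵈ.∣⇒≤ (∣⇒∣ᵤ h)) (prime>1 pl))
    lem : ∀ s → s * s - (s * s - 1ℤ) ≡ 1ℤ
    lem = solve-∀
    l∤s : ¬ + l ∣ s 1
    l∤s h = l∤1 (≡.subst (+ l ∣_) (lem (s 1)) (∣m∣n⇒∣m-n (∣m⇒∣m*n (s 1) h) (proj₂ (sqrt (+ 1)))))
  collide : (∃[ i ] ∃[ j ] i Fin.< j × fromℕ< (n%ℕd<d (root i) l) ≡ fromℕ< (n%ℕd<d (root j) l)) → ⊥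
  collide (i , j , i<j , e) = go i j i<j
    (%ℕ-injective l (root i) (root j) (Fin.fromℕ<-injective _ _ _ _ e))
    where
    go : ∀ i j → i Fin.< j → + l ∣ root i - root j → ⊥
    go (Fin.suc i) (Fin.suc j) (s≤s i<j) d = ℕ.<⇒≢ i<j (≡-residues (Fin.toℕ<n i) (Fin.toℕ<n j)
      (squares-agree {s (toℕ i)} (toℕ i) (toℕ j) (proj₂ (sqrt (+ toℕ i))) d))
    -- The square of -`s 1` is 1, so the residue `j` colliding with it must be 1. Then `s 1` and
    -- -`s 1` agree modulo `l`, which is impossible for odd `l`.
    go Fin.zero (Fin.suc j) _ d = no-fixed (≡.subst (λ c → + l ∣ - s 1 - s c)
      (≡.sym (≡-residues (prime>1 pl) (Fin.toℕ<n j) (squares-agree { - s 1} 1 (toℕ j)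
        (≡.subst (+ l ∣_) (neg-square (s 1) (+ 1)) (proj₂ (sqrt (+ 1)))) d))) d)

-- Adjoining √5 to ℚ₂ gives its unramified quadratic extension, so z² - 5x² has even valuation at 2,
-- while 2u y² has odd valuation. Concretely, for odd `x` also `z` is odd, z² - 5x² is 4 modulo 8,
-- and u y² would be 2 modulo 4.
five-anisotropic : ∀ u → ¬ + 2 ∣ u → ¬ IsotropicAt 2 (normal (+ 5) (u * + 2))
five-anisotropic u 2∤u iso = go (primitive-solution prime-2 (normal (+ 5) (u * + 2)) iso 3)
  where
  module _ x y z (h : + 8 ∣ diag (normal (+ 5) (u * + 2)) (x , y , z)) where
    2∣norm : + 2 ∣ z * z - + 5 * (x * x)
    2∣norm = divides-norm (+ 5) u (+ 2) x y z (∣-trans (divides (+ 2) ≡.refl) h)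
    x-odd : ¬ + 2 ∣ x - 1ℤ
    x-odd xo = [ z-even , z-odd ]′ (parity z)
      where
      lem₁ : ∀ x z → z * z - (z * z - + 5 * (x * x)) - + 4 * (x * x) - (x * x - 1ℤ) ≡ 1ℤ
      lem₁ = solve-∀
      z-even : ¬ + 2 ∣ z
      z-even ze = from-no (+ 2 ∣? 1ℤ) (≡.subst (+ 2 ∣_) (lem₁ x z)
        (∣m∣n⇒∣m-n (∣m∣n⇒∣m-n (∣m∣n⇒∣m-n (∣m⇒∣m*n z ze) 2∣norm)
          (∣m⇒∣m*n (x * x) (divides (+ 2) ≡.refl)))
          (∣-trans (divides (+ 4) ≡.refl) (odd-square {x} xo))))
      lem₂ : ∀ u x y z → z * z - 1ℤ - + 5 * (x * x - 1ℤ) -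
        (- + 5 * (x * x) + - (u * + 2) * (y * y) + 1ℤ * (z * z)) ≡ + 2 * (u * (y * y) + + 2)
      lem₂ = solve-∀
      z-odd : ¬ + 2 ∣ z - 1ℤ
      z-odd zo = [ 2∤u , y-even ]′ (euclid prime-2 u (y * y)
          (∣m+n∣n⇒∣m {+ 2} {u * (y * y)} {+ 2} (∣-trans (divides (+ 2) ≡.refl) 4∣) ∣-refl))
        where
        4∣ : + 4 ∣ u * (y * y) + + 2
        4∣ = *-cancelˡ-∣ (+ 2) {+ 4} {u * (y * y) + + 2} (≡.subst (+ 8 ∣_) (lem₂ u x y z)
          (∣m∣n⇒∣m-n (∣m∣n⇒∣m-n (odd-square {z} zo) (∣n⇒∣m*n (+ 5) (odd-square {x} xo))) h))
        y-even : ¬ + 2 ∣ y * y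
        y-even d = from-no (+ 4 ∣? + 2) (∣m+n∣m⇒∣n {+ 4} {u * (y * y)} {+ 2} 4∣
          (∣n⇒∣m*n u (even-square {y} (euclid² prime-2 y d))))
    all-even : + 2 ∣³ (x , y , z)
    all-even = divides-all (+ 5) u (+ 2) x y z (∣-trans (divides (+ 2) ≡.refl) h)
      (euclid prime-2) 2∤u ([ id , (λ xo → ⊥-elim (x-odd xo)) ]′ (parity x))
  go : ∃[ v ] + 8 ∣ diag (normal (+ 5) (u * + 2)) v × ¬ + 2 ∣³ v → ⊥
  go ((x , y , z) , h , n) = n (all-even x y z h)

module SquareCriterion (em : ExcludedMiddle 0ℓ) where
  open Classical em

  -- √c generates the unramified quadratic extension of ℚ_l: the norm z² - c x² has even valuation,
  -- against the odd one of u l y². A single `c` has to serve all `u`, because the `u` to which this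
  -- is applied itself depends on `c`.
  anisotropic-coefficient : ∀ {l} → Prime l →
    ∃[ c ] ∀ u → ¬ + l ∣ u → ¬ IsotropicAt l (normal c (u * + l))
  anisotropic-coefficient {l} pl with l ℕ.≟ 2
  ... | yes ≡.refl = + 5 , five-anisotropic
  ... | no l≢2 with em {∃[ c ] ¬ IsSquareMod (+ l) c}
  ...   | yes (c , ns) = c , λ u l∤u iso → ns (isotropicAt⇒square-mod pl c u l∤u iso)
  ...   | no h = ⊥-elim (¬all-squares pl l≢2 λ c → decidable-stable em λ ¬sq → h (c , ¬sq))

  -- Diagonal form obtained from a relation αP + βQ + γR = 0 when Q is set to cP.
  relation-form : ℤ → ℤ → ℤ → ℤ → ℤ³
  relation-form α β γ c = γ , γ * c , - (α + β * c)

  -- Multiplied by γ, the form is X² - cY² - (αγ - cβγ(ls)²) z². Its parameter differs from -c by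
  -- the square (ls)², which leaves the square class alone. The factor s² can then be absorbed into
  -- z, and l² makes the perturbation of αγ divisible by one more `l` than `u l s²` visibly is, so
  -- it changes `u` only by a multiple of `l`.
  prime-transfer : ∀ α β {γ l s} u c → γ ≢ 0ℤ → l ≢ 0ℤ → s ≢ 0ℤ → α * γ ≡ u * l * (s * s) →
    Transfer (relation-form α β γ (- (c * (l * s * (l * s)))))
             (normal c ((u - c * β * γ * l) * l))
  prime-transfer α β {γ} {l} {s} u c γ≢0 l≢0 s≢0 e = record
    { map      = λ { (x , y , z) → γ * (l * s) * y , s * z , γ * x }
    ; factor   = γ
    ; det      = γ * (l * s) * s
    ; det≢0    = *-≢0 (*-≢0 γ≢0 (*-≢0 l≢0 s≢0)) s≢0
    ; diag-map = λ { (x , y , z) → ≡.trans (lem₁ β γ u l s c x y z)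
        (≡.trans (≡.cong (λ a → γ * γ * (x * x) - c * (γ * γ) * (l * s * (l * s)) * (y * y)
                            - (a - c * β * γ * (l * l) * (s * s)) * (z * z)) (≡.sym e))
          (lem₂ α β γ l s c x y z)) }
    ; reflects = λ { d (x , y , z) (dx , dy , dz) →
        ≡.subst (d ∣_) (lem₃ γ (l * s) s x) (∣n⇒∣m*n (l * s * s) dz) ,
        ≡.subst (d ∣_) (lem₄ (γ * (l * s)) s y) (∣n⇒∣m*n s dx) ,
        ≡.subst (d ∣_) (≡.sym (ℤ.*-assoc (γ * (l * s)) s z)) (∣n⇒∣m*n (γ * (l * s)) dy) }
    }
    where
    lem₁ : ∀ β γ u l s c x y z →
      - c * (γ * (l * s) * y * (γ * (l * s) * y)) + - ((u - c * β * γ * l) * l) * (s * z * (s * z))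
        + 1ℤ * (γ * x * (γ * x)) ≡
      γ * γ * (x * x) - c * (γ * γ) * (l * s * (l * s)) * (y * y)
        - (u * l * (s * s) - c * β * γ * (l * l) * (s * s)) * (z * z)
    lem₁ = solve-∀
    lem₂ : ∀ α β γ l s c x y z →
      γ * γ * (x * x) - c * (γ * γ) * (l * s * (l * s)) * (y * y)
        - (α * γ - c * β * γ * (l * l) * (s * s)) * (z * z) ≡
      γ * (γ * (x * x) + γ * - (c * (l * s * (l * s))) * (y * y)
        + - (α + β * - (c * (l * s * (l * s)))) * (z * z))
    lem₂ = solve-∀
    lem₃ : ∀ γ m s x → m * s * (γ * x) ≡ γ * m * s * x
    lem₃ = solve-∀
    lem₄ : ∀ m s y → s * (m * y) ≡ m * s * y
    lem₄ = solve-∀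

  -- The parameter 4s² is a square, so the middle coefficient becomes 1; its factor 4 hides the
  -- contribution of β modulo 4, and s² is absorbed into `z`.
  negative-transfer : ∀ α β {γ s} → γ ≢ 0ℤ → s ≢ 0ℤ → α * γ ≡ -1ℤ * (s * s) →
    Transfer (relation-form α β γ (+ 2 * s * (+ 2 * s)))
             (1ℤ , 1ℤ , 1ℤ + + 4 * - (β * γ))
  negative-transfer α β {γ} {s} γ≢0 s≢0 e = record
    { map      = λ { (x , y , z) → γ * x , γ * (+ 2 * s) * y , s * z }
    ; factor   = γ
    ; det      = γ * (+ 2 * s) * s
    ; det≢0    = *-≢0 (*-≢0 γ≢0 (*-≢0 {+ 2} (λ ()) s≢0)) s≢0
    ; diag-map = λ { (x , y , z) → ≡.trans (lem₁ β γ s x y z)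
        (≡.trans (≡.cong (λ a → γ * γ * (x * x) + γ * γ * (+ 2 * s * (+ 2 * s)) * (y * y)
                            - (a + β * γ * (+ 4 * (s * s))) * (z * z)) (≡.sym e))
          (lem₂ α β γ s x y z)) }
    ; reflects = λ { d (x , y , z) (dx , dy , dz) →
        ≡.subst (d ∣_) (lem₃ γ (+ 2 * s) s x) (∣n⇒∣m*n (+ 2 * s * s) dx) ,
        ≡.subst (d ∣_) (lem₄ (γ * (+ 2 * s)) s y) (∣n⇒∣m*n s dy) ,
        ≡.subst (d ∣_) (≡.sym (ℤ.*-assoc (γ * (+ 2 * s)) s z)) (∣n⇒∣m*n (γ * (+ 2 * s)) dz) }
    }
    where
    lem₁ : ∀ β γ s x y z →
      1ℤ * (γ * x * (γ * x)) + 1ℤ * (γ * (+ 2 * s) * y * (γ * (+ 2 * s) * y))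
        + (1ℤ + + 4 * - (β * γ)) * (s * z * (s * z)) ≡
      γ * γ * (x * x) + γ * γ * (+ 2 * s * (+ 2 * s)) * (y * y)
        - (-1ℤ * (s * s) + β * γ * (+ 4 * (s * s))) * (z * z)
    lem₁ = solve-∀
    lem₂ : ∀ α β γ s x y z →
      γ * γ * (x * x) + γ * γ * (+ 2 * s * (+ 2 * s)) * (y * y)
        - (α * γ + β * γ * (+ 4 * (s * s))) * (z * z) ≡
      γ * (γ * (x * x) + γ * (+ 2 * s * (+ 2 * s)) * (y * y)
        + - (α + β * (+ 2 * s * (+ 2 * s))) * (z * z))
    lem₂ = solve-∀
    lem₃ : ∀ γ m s x → m * s * (γ * x) ≡ γ * m * s * x
    lem₃ = solve-∀
    lem₄ : ∀ m s y → s * (m * y) ≡ m * s * y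
    lem₄ = solve-∀

  square-criterion : ∀ α β {γ} → γ ≢ 0ℤ →
    (∀ c → LocallyIsotropic (relation-form α β γ c)) → ∃[ s ] α * γ ≡ s * s
  square-criterion α β {γ} γ≢0 loc with α ℤ.≟ 0ℤ
  ... | yes ≡.refl = 0ℤ , ≡.refl
  ... | no α≢0 with squarefree-decomposition (α * γ) (*-≢0 α≢0 γ≢0)
  ...   | a , s , e , s≢0 , sf , _ = by-size a (λ { ≡.refl → *-≢0 α≢0 γ≢0 e }) sf e
    where
    large : ∀ a → 1 ℕ.< ℤ.∣ a ∣ → Squarefree a → α * γ ≡ a * (s * s) → ⊥
    large a 1<a sf e with prime-divisor ℤ.∣ a ∣ 1<a
    ... | l , pl , l∣a with ∣ᵤ⇒∣ {+ l} {a} l∣a | anisotropic-coefficient pl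
    ...   | divides u ≡.refl | c , aniso = aniso (u - c * β * γ * + l) l∤u′
      (transfer-isotropicAt (prime-transfer α β u c γ≢0 l≢0 s≢0 e) pl (loc _ pl))
      where
      l≢0 : + l ≢ 0ℤ
      l≢0 ≡.refl = contradiction (prime⇒nonZero pl) λ ()
      l∤u′ : ¬ + l ∣ u - c * β * γ * + l
      l∤u′ d = sf pl (*-monoˡ-∣ (+ l) (∣-diff {x = u} (c * β * γ * + l) d (divides (c * β * γ) ≡.refl)))
    by-size : ∀ a → a ≢ 0ℤ → Squarefree a → α * γ ≡ a * (s * s) → ∃[ t ] α * γ ≡ t * t
    by-size (+ 0) a≢0 _ _ = contradiction ≡.refl a≢0
    by-size (+ 1) _ _ e = s , ≡.trans e (ℤ.*-identityˡ (s * s))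
    by-size -[1+ 0 ] _ _ e = contradiction
      (transfer-isotropicAt (negative-transfer α β γ≢0 s≢0 e) prime-2 (loc _ prime-2))
      (three-squares-anisotropic (- (β * γ)))
    by-size a@(+ suc (suc _)) _ sf e = ⊥-elim (large a (s≤s (s≤s z≤n)) sf e)
    by-size a@(-[1+ suc _ ]) _ sf e = ⊥-elim (large a (s≤s (s≤s z≤n)) sf e)

-- Abelian groups as ℤ-modules

module ℤ-Module {c ℓ} (G : AbelianGroup c ℓ) where
  open AbelianGroup G hiding (_-_)
  open GroupNotions G
  open AbelianGroupProperties G using (⁻¹-∙-comm)
  open GroupProperties group using (ε⁻¹≈ε; ⁻¹-involutive)
  open Mult commutativeMonoid using (×-homo-+; ×-distrib-+; ×-congʳ)
  open CommutativeSemigroupProperties commutativeSemigroup using (interchange)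
  open import Relation.Binary.Reasoning.Setoid setoid

  ·-congˡ : ∀ k {g h} → g ≈ h → k · g ≈ k · h
  ·-congˡ (+ n)    e = ×-congʳ n e
  ·-congˡ -[1+ n ] e = ⁻¹-cong (×-congʳ (suc n) e)

  ·-congʳ : ∀ {j k} g → j ≡ k → j · g ≈ k · g
  ·-congʳ g ≡.refl = refl

  ·-⊖ : ∀ m n g → (m ℤ.⊖ n) · g ≈ (m ·ℕ g) ∙ (n ·ℕ g) ⁻¹
  ·-⊖ m zero g = begin
    m ·ℕ g           ≈⟨ identityʳ _ ⟨
    (m ·ℕ g) ∙ ε       ≈⟨ ∙-congˡ ε⁻¹≈ε ⟨
    (m ·ℕ g) ∙ ε ⁻¹    ∎
  ·-⊖ zero (suc n) g = sym (identityˡ _)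
  ·-⊖ (suc m) (suc n) g = begin
    (suc m ℤ.⊖ suc n) · g   ≈⟨ ·-congʳ g (ℤ.[1+m]⊖[1+n]≡m⊖n m n) ⟩
    (m ℤ.⊖ n) · g           ≈⟨ ·-⊖ m n g ⟩
    (m ·ℕ g) ∙ (n ·ℕ g) ⁻¹    ≈⟨ identityˡ _ ⟨
    ε ∙ ((m ·ℕ g) ∙ (n ·ℕ g) ⁻¹)  ≈⟨ ∙-congʳ (inverseʳ g) ⟨
    g ∙ g ⁻¹ ∙ ((m ·ℕ g) ∙ (n ·ℕ g) ⁻¹)  ≈⟨ interchange g (g ⁻¹) _ _ ⟩
    g ∙ (m ·ℕ g) ∙ (g ⁻¹ ∙ (n ·ℕ g) ⁻¹)  ≈⟨ ∙-congˡ (⁻¹-∙-comm g (n ·ℕ g)) ⟩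
    (suc m ·ℕ g) ∙ (suc n ·ℕ g) ⁻¹ ∎

  ·-homo-+ : ∀ j k g → (j + k) · g ≈ j · g ∙ k · g
  ·-homo-+ (+ m) (+ n) g = ×-homo-+ g m n
  ·-homo-+ (+ m) -[1+ n ] g = ·-⊖ m (suc n) g
  ·-homo-+ -[1+ m ] (+ n) g = trans (·-⊖ n (suc m) g) (comm _ _)
  ·-homo-+ -[1+ m ] -[1+ n ] g = begin
    (suc (suc (m ℕ.+ n)) ·ℕ g) ⁻¹   ≡⟨ ≡.cong (λ k → (suc k ·ℕ g) ⁻¹) (ℕ.+-suc m n) ⟨
    ((suc m ℕ.+ suc n) ·ℕ g) ⁻¹     ≈⟨ ⁻¹-cong (×-homo-+ g (suc m) (suc n)) ⟩
    ((suc m ·ℕ g) ∙ (suc n ·ℕ g)) ⁻¹  ≈⟨ ⁻¹-∙-comm _ _ ⟨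
    (suc m ·ℕ g) ⁻¹ ∙ (suc n ·ℕ g) ⁻¹ ∎

  ·-homo-neg : ∀ k g → (- k) · g ≈ (k · g) ⁻¹
  ·-homo-neg (+ 0) g = sym ε⁻¹≈ε
  ·-homo-neg (+ suc n) g = refl
  ·-homo-neg -[1+ n ] g = sym (⁻¹-involutive _)

  ·-distrib-∙ : ∀ k g h → k · (g ∙ h) ≈ k · g ∙ k · h
  ·-distrib-∙ (+ n) g h = ×-distrib-+ g h n
  ·-distrib-∙ -[1+ n ] g h = trans (⁻¹-cong (×-distrib-+ g h (suc n))) (sym (⁻¹-∙-comm _ _))

  ·-assoc : ∀ j k g → (j * k) · g ≈ j · (k · g)
  ·-assoc (+ n) k g = nonneg n
    where
    nonneg : ∀ n → (+ n * k) · g ≈ n ·ℕ (k · g)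
    nonneg zero = refl
    nonneg (suc n) = begin
      (+ suc n * k) · g     ≈⟨ ·-congʳ g (ℤ.suc-* (+ n) k) ⟩
      (k + + n * k) · g     ≈⟨ ·-homo-+ k (+ n * k) g ⟩
      k · g ∙ (+ n * k) · g ≈⟨ ∙-congˡ (nonneg n) ⟩
      suc n ·ℕ (k · g)      ∎
  ·-assoc -[1+ n ] k g = begin
    (-[1+ n ] * k) · g      ≈⟨ ·-congʳ g (ℤ.neg-distribˡ-* (+ suc n) k) ⟨
    (- (+ suc n * k)) · g   ≈⟨ ·-homo-neg (+ suc n * k) g ⟩
    ((+ suc n * k) · g) ⁻¹  ≈⟨ ⁻¹-cong (·-assoc (+ suc n) k g) ⟩
    (suc n ·ℕ (k · g)) ⁻¹   ∎

  ·-comm : ∀ j k g → j · (k · g) ≈ k · (j · g)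
  ·-comm j k g = trans (sym (·-assoc j k g)) (trans (·-congʳ g (ℤ.*-comm j k)) (·-assoc k j g))

  ·-zeroʳ : ∀ k → k · ε ≈ ε
  ·-zeroʳ k = trans (sym (·-assoc k 0ℤ ε)) (·-congʳ ε (ℤ.*-zeroʳ k))

  ·-kill : ∀ k {g} → g ≈ ε → k · g ≈ ε
  ·-kill k e = trans (·-congˡ k e) (·-zeroʳ k)

  nonzero-multiple⇒torsion : ∀ {k g} → k ≢ 0ℤ → k · g ≈ ε → IsTorsion g
  nonzero-multiple⇒torsion {+ 0} k≢0 e = contradiction ≡.refl k≢0
  nonzero-multiple⇒torsion {+ suc n} k≢0 e = suc n , s≤s z≤n , e
  nonzero-multiple⇒torsion { -[1+ n ]} {g} k≢0 e = suc n , s≤s z≤n , (begin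
    suc n ·ℕ g           ≈⟨ ⁻¹-involutive _ ⟨
    (suc n ·ℕ g) ⁻¹ ⁻¹   ≈⟨ ⁻¹-cong e ⟩
    ε ⁻¹                 ≈⟨ ε⁻¹≈ε ⟩
    ε                    ∎)

  order-divides : ∀ {g n} → IsOrder g n → ∀ k → k · g ≈ ε → + n ∣ k
  order-divides {g} {n} (0<n , ng≈ε , least) k kg≈ε = remainder (k %ℕ n) ≡.refl
    where
    instance _ = ℕ.>-nonZero 0<n
    q = k /ℕ n
    rg≈ε : (k %ℕ n) ·ℕ g ≈ ε
    rg≈ε = begin
      (+ (k %ℕ n)) · g                          ≈⟨ identityʳ _ ⟨
      (+ (k %ℕ n)) · g ∙ ε                      ≈⟨ ∙-congˡ (·-kill q ng≈ε) ⟨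
      (+ (k %ℕ n)) · g ∙ q · ((+ n) · g)        ≈⟨ ∙-congˡ (·-assoc q (+ n) g) ⟨
      (+ (k %ℕ n)) · g ∙ (q * + n) · g          ≈⟨ ·-homo-+ (+ (k %ℕ n)) (q * + n) g ⟨
      (+ (k %ℕ n) + q * + n) · g                ≈⟨ ·-congʳ g (a≡a%ℕn+[a/ℕn]*n k n) ⟨
      k · g                                     ≈⟨ kg≈ε ⟩
      ε                                         ∎
    remainder : ∀ r → k %ℕ n ≡ r → + n ∣ k
    remainder zero e = divides q (≡.trans (a≡a%ℕn+[a/ℕn]*n k n)
      (≡.trans (≡.cong (λ r → + r + q * + n) e) (ℤ.+-identityˡ _)))
    remainder (suc r) e = contradiction
      (least (k %ℕ n) (≡.subst (0 ℕ.<_) (≡.sym e) (s≤s z≤n)) rg≈ε) (ℕ.<⇒≱ (n%ℕd<d k n))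

  finite⇒torsion : ∀ xs → (∀ g → Membership._∈_ setoid g xs) → ∀ g → IsTorsion g
  finite⇒torsion xs enum g = collide (Fin.pigeonhole (ℕ.n<1+n (length xs)) (λ i → Any.index (enum (toℕ i ·ℕ g))))
    where
    collide : (∃[ i ] ∃[ j ] i Fin.< j × Any.index (enum (toℕ i ·ℕ g)) ≡ Any.index (enum (toℕ j ·ℕ g))) →
              IsTorsion g
    collide (i , j , i<j , e) = nonzero-multiple⇒torsion {+ toℕ j - + toℕ i}
      (λ h → ℕ.<⇒≢ i<j (≡.sym (ℤ.+-injective (ℤ.i-j≡0⇒i≡j (+ toℕ j) (+ toℕ i) h)))) (begin
      (+ toℕ j - + toℕ i) · g              ≈⟨ ·-homo-+ (+ toℕ j) (- + toℕ i) g ⟩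
      (toℕ j ·ℕ g) ∙ (- + toℕ i) · g         ≈⟨ ∙-congˡ (·-homo-neg (+ toℕ i) g) ⟩
      (toℕ j ·ℕ g) ∙ (toℕ i ·ℕ g) ⁻¹         ≈⟨ ∙-congʳ
        (Membershipₚ.index-injective setoid (enum _) (enum _) (≡.sym e)) ⟩
      (toℕ i ·ℕ g) ∙ (toℕ i ·ℕ g) ⁻¹         ≈⟨ inverseʳ _ ⟩
      ε                                    ∎)

  common-exponent : ∀ xs → (∀ g → IsTorsion g) →
                    ∃[ n ] 0 ℕ.< n × (∀ {g} → Membership._∈_ setoid g xs → n ·ℕ g ≈ ε)
  common-exponent [] tors = 1 , s≤s z≤n , λ ()
  common-exponent (x ∷ xs) tors =
    let m , 0<m , mx≈ε = tors x
        n , 0<n , kills = common-exponent xs tors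
    in m ℕ.* n , ℕ.*-mono-< 0<m 0<n , λ
      { {g} (here g≈x) → begin
          (m ℕ.* n) ·ℕ g       ≈⟨ ·-congʳ g (ℤ.pos-* m n) ⟩
          (+ m * + n) · g      ≈⟨ ·-assoc (+ m) (+ n) g ⟩
          (+ m) · ((+ n) · g)  ≈⟨ ·-comm (+ m) (+ n) g ⟩
          (+ n) · ((+ m) · g)  ≈⟨ ·-kill (+ n) (trans (·-congˡ (+ m) g≈x) mx≈ε) ⟩
          ε ∎
      ; {g} (there g∈xs) → begin
          (m ℕ.* n) ·ℕ g       ≈⟨ ·-congʳ g (ℤ.pos-* m n) ⟩
          (+ m * + n) · g      ≈⟨ ·-assoc (+ m) (+ n) g ⟩
          (+ m) · ((+ n) · g)  ≈⟨ ·-kill (+ m) (kills g∈xs) ⟩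
          ε ∎ }

  finite⇒exponent : IsFinite setoid → ∃[ n ] 0 ℕ.< n × (∀ g → n ·ℕ g ≈ ε)
  finite⇒exponent (xs , enum) =
    let n , 0<n , kills = common-exponent xs (finite⇒torsion xs enum)
    in n , 0<n , λ g → kills (enum g)

  -- The product of the annihilators works and stays prime to `l` by Euclid's lemma. It will discard
  -- all basis points but one without losing any power of `l`.
  kill-sum : ∀ {l} → Prime l → ∀ {m} (s : Fin m → ℤ) (h : Fin m → Carrier) →
             (∀ i → ∃[ n ] ¬ + l ∣ + n × n ·ℕ h i ≈ ε) →
             ∃[ M ] ¬ + l ∣ M × M · sum (λ i → s i · h i) ≈ ε
  kill-sum pl {zero} s h kill = 1ℤ ,
    (λ d → contradiction (ℕᵈ.∣1⇒≡1 (∣⇒∣ᵤ d)) (ℕ.>⇒≢ (prime>1 pl))) , ·-zeroʳ 1ℤ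
  kill-sum pl {suc m} s h kill =
    let n , l∤n , nh≈ε = kill Fin.zero
        M , l∤M , Msum≈ε = kill-sum pl (λ i → s (Fin.suc i)) (λ i → h (Fin.suc i)) (λ i → kill (Fin.suc i))
        rest = sum (λ i → s (Fin.suc i) · h (Fin.suc i))
    in + n * M , (λ d → [ l∤n , l∤M ]′ (euclid pl (+ n) M d)) , (begin
      (+ n * M) · (s Fin.zero · h Fin.zero ∙ rest)
        ≈⟨ ·-distrib-∙ (+ n * M) _ _ ⟩
      (+ n * M) · (s Fin.zero · h Fin.zero) ∙ (+ n * M) · rest
        ≈⟨ ∙-cong (begin
             (+ n * M) · (s Fin.zero · h Fin.zero)  ≈⟨ ·-comm (+ n * M) (s Fin.zero) _ ⟩
             s Fin.zero · ((+ n * M) · h Fin.zero)  ≈⟨ ·-congˡ (s Fin.zero) (·-assoc (+ n) M _) ⟩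
             s Fin.zero · ((+ n) · (M · h Fin.zero)) ≈⟨ ·-congˡ (s Fin.zero) (·-comm (+ n) M _) ⟩
             s Fin.zero · (M · ((+ n) · h Fin.zero)) ≈⟨ ·-kill (s Fin.zero) (·-kill M nh≈ε) ⟩
             ε ∎)
           (trans (·-assoc (+ n) M rest) (·-kill (+ n) Msum≈ε)) ⟩
      ε ∙ ε ≈⟨ identityˡ ε ⟩
      ε ∎)

  infixl 6 _+³_
  _+³_ : ℤ³ → ℤ³ → ℤ³
  (a , b , c) +³ (a′ , b′ , c′) = a + a′ , b + b′ , c + c′

  module Combination (P Q R : Carrier) where

    combination : ℤ³ → Carrier
    combination (a , b , c) = a · P ∙ b · Q ∙ c · R

    combination-+ : ∀ u v → combination (u +³ v) ≈ combination u ∙ combination v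
    combination-+ (a , b , c) (a′ , b′ , c′) = begin
      (a + a′) · P ∙ (b + b′) · Q ∙ (c + c′) · R
        ≈⟨ ∙-cong (∙-cong (·-homo-+ a a′ P) (·-homo-+ b b′ Q)) (·-homo-+ c c′ R) ⟩
      (a · P ∙ a′ · P) ∙ (b · Q ∙ b′ · Q) ∙ (c · R ∙ c′ · R)
        ≈⟨ ∙-congʳ (interchange _ _ _ _) ⟩
      (a · P ∙ b · Q) ∙ (a′ · P ∙ b′ · Q) ∙ (c · R ∙ c′ · R)
        ≈⟨ interchange _ _ _ _ ⟩
      a · P ∙ b · Q ∙ c · R ∙ (a′ · P ∙ b′ · Q ∙ c′ · R) ∎

    combination-* : ∀ k v → combination (k *³ v) ≈ k · combination v
    combination-* k (a , b , c) = begin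
      (k * a) · P ∙ (k * b) · Q ∙ (k * c) · R
        ≈⟨ ∙-cong (∙-cong (·-assoc k a P) (·-assoc k b Q)) (·-assoc k c R) ⟩
      k · (a · P) ∙ k · (b · Q) ∙ k · (c · R)
        ≈⟨ ∙-congʳ (·-distrib-∙ k _ _) ⟨
      k · (a · P ∙ b · Q) ∙ k · (c · R)
        ≈⟨ ·-distrib-∙ k _ _ ⟨
      k · (a · P ∙ b · Q ∙ c · R) ∎

    combination-cong : ∀ {u v} → u ≡ v → combination u ≈ combination v
    combination-cong ≡.refl = refl

    combination-0 : combination (0ℤ , 0ℤ , 0ℤ) ≈ ε
    combination-0 = trans (identityʳ _) (identityʳ _)

    sum³ : ∀ {m} → (Fin m → ℤ³) → ℤ³
    sum³ {zero}  f = 0ℤ , 0ℤ , 0ℤ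
    sum³ {suc m} f = f Fin.zero +³ sum³ (λ i → f (Fin.suc i))

    sum-combination : ∀ {m} (s : Fin m → ℤ) (g : Fin m → ℤ³) →
      sum (λ i → s i · combination (g i)) ≈ combination (sum³ (λ i → s i *³ g i))
    sum-combination {zero}  s g = sym combination-0
    sum-combination {suc m} s g = trans
      (∙-cong (sym (combination-* (s Fin.zero) (g Fin.zero)))
        (sum-combination (λ i → s (Fin.suc i)) (λ i → g (Fin.suc i))))
      (sym (combination-+ (s Fin.zero *³ g Fin.zero)
        (sum³ (λ i → s (Fin.suc i) *³ g (Fin.suc i)))))

-- Sets of primes of positive density

-- A positive rational is at least the reciprocal of its denominator. For denominator 0 the ratio is
-- 0 by convention, which contradicts the lower bound.
ratio-bound : ∀ {ε} → 0ℚ ℚ.< ε → ∀ m n → ε ℚ.< ratio m n →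
              0 ℕ.< m × n ℕ.≤ m ℕ.* ℚ.↧ₙ ε
ratio-bound 0<ε m zero ε<r = contradiction (ℚ.<-trans 0<ε ε<r) (ℚ.<-irrefl ≡.refl)
ratio-bound {ε@record{}} 0<ε m (suc n) ε<r = bound ε 0<ε
    (ℚᵘ.drop-*<* (ℚᵘ.<-respʳ-≃ (ℚ.toℚᵘ-fromℚᵘ (ℚᵘ.mkℚᵘ (+ m) n))
      (ℚ.toℚᵘ-mono-< {ε} {ratio m (suc n)} ε<r)))
  where
  bound : ∀ ε → 0ℚ ℚ.< ε → ℚ.↥ ε * + suc n ℤ.< + m * ℚ.↧ ε → 0 ℕ.< m × suc n ℕ.≤ m ℕ.* ℚ.↧ₙ ε
  bound (mkℚ (+ 0) _ _) (ℚ.*<* (ℤ.+<+ ()))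
  bound (mkℚ -[1+ _ ] _ _) (ℚ.*<* ())
  bound (mkℚ (+ suc k) d _) _ h = positive m lt , ℕ.<⇒≤ (ℕ.≤-<-trans (ℕ.m≤n*m (suc n) (suc k)) lt)
    where
    lt : suc k ℕ.* suc n ℕ.< m ℕ.* suc d
    lt = ℤ.drop‿+<+ (≡.subst₂ ℤ._<_ (≡.sym (ℤ.pos-* (suc k) (suc n))) (≡.sym (ℤ.pos-* m (suc d))) h)
    positive : ∀ m → suc k ℕ.* suc n ℕ.< m ℕ.* suc d → 0 ℕ.< m
    positive (suc m) _ = s≤s z≤n

-- This is what the density limit is used for: from some norm bound on, the set is nonempty and
-- makes up at least 1/D of the primes. One half of `ε` absorbs the error of the limit.
limit-bound : ∀ {num den : ℕ → ℕ} {δ} → Positive δ → (λ x → ratio (num x) (den x)) ⟶ δ →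
              ∃[ D ] ∃[ N ] (∀ x → N ℕ.≤ x → 0 ℕ.< num x × den x ℕ.≤ num x ℕ.* D)
limit-bound {num} {den} {δ} (ε , 0<ε , N , ε≤δ) lim =
  ℚ.↧ₙ ε/2 , N ℕ.⊔ N′ , λ x N≤x → ratio-bound 0<ε/2 (num x) (den x)
    (ε/2<ratio x (ε≤δ x (ℕ.≤-trans (ℕ.m≤m⊔n N N′) N≤x)) (close x (ℕ.≤-trans (ℕ.m≤n⊔m N N′) N≤x)))
  where
  ε/2 : ℚ
  ε/2 = ε ℚ.* ½
  0<ε/2 : 0ℚ ℚ.< ε/2
  0<ε/2 = ℚ.*-monoˡ-<-pos ½ 0<ε
  halves : ε/2 ℚ.+ ε/2 ≡ ε
  halves = ≡.trans (≡.sym (ℚ.*-distribˡ-+ ε ½ ½)) (ℚ.*-identityʳ ε)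
  N′ = proj₁ (lim ε/2 0<ε/2)
  close = proj₂ (lim ε/2 0<ε/2)
  ε/2<ratio : ∀ x → ε ℚ.≤ ℝ.seq δ x →
              ℚ.∣ ratio (num x) (den x) ℚ.- ℝ.seq δ x ∣ ℚ.< ε/2 → ε/2 ℚ.< ratio (num x) (den x)
  ε/2<ratio x ε≤t d = ℚ.≰⇒> λ s≤ε/2 → let ε/2≤t-s = gap s≤ε/2 in
    ℚ.<-irrefl ≡.refl (ℚ.≤-<-trans ε/2≤t-s (≡.subst (ℚ._< ε/2)
      (≡.trans (≡.trans (≡.cong ℚ.∣_∣ (≡.sym (⁻¹-anti-homo‿- t s))) (ℚ.∣-p∣≡∣p∣ (t ℚ.- s)))
        (ℚ.0≤p⇒∣p∣≡p (ℚ.≤-trans (ℚ.<⇒≤ 0<ε/2) ε/2≤t-s))) d))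
    where
    s = ratio (num x) (den x)
    t = ℝ.seq δ x
    gap : s ℚ.≤ ε/2 → ε/2 ℚ.≤ t ℚ.- s
    gap s≤ε/2 = ≡.subst (ℚ._≤ t ℚ.- s)
      (≡.trans (≡.cong (ℚ._- ε/2) (≡.sym halves)) (//-rightDividesʳ ε/2 ε/2))
      (ℚ.+-mono-≤ ε≤t (ℚ.neg-antimono-≤ s≤ε/2))

module _ {a ℓ p} {A : Set a} {_≈_ : Rel A ℓ} (≈-sym : Symmetric _≈_) (≈-trans : Transitive _≈_)
         {Q : Pred A p} {n} (card : HasCardinality _≈_ Q n) where

  injection⇒≤-cardinality : ∀ {k} (g : Fin k → A) → (∀ i → g i ∈ Q) → Injective _≡_ _≈_ g → k ℕ.≤ n
  injection⇒≤-cardinality g g∈Q g-inj = let f , _ , _ , complete = card in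
    Fin.injective⇒≤ {f = λ i → proj₁ (complete (g i) (g∈Q i))} λ {i} {j} e →
      g-inj (≈-trans (≈-sym (proj₂ (complete (g i) (g∈Q i))))
        (≡.subst (λ k → f k ≈ g j) (≡.sym e) (proj₂ (complete (g j) (g∈Q j)))))

finite-maximum : ∀ {n} (f : Fin n → ℕ) → ∃[ b ] (∀ i → f i ℕ.≤ b)
finite-maximum {zero}  f = 0 , λ ()
finite-maximum {suc n} f = let b , f≤b = finite-maximum (f ∘ Fin.suc) in
  f Fin.zero ℕ.⊔ b , λ
    { Fin.zero    → ℕ.m≤m⊔n _ b
    ; (Fin.suc i) → ℕ.≤-trans (f≤b i) (ℕ.m≤n⊔m _ b) }

exact-power-unique : ∀ {l j k n} → l ^ j ∥ n → l ^ k ∥ n → j ≡ k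
exact-power-unique {l} {j} {k} {n} (l^j∣n , l^1+j∤n) (l^k∣n , l^1+k∤n) =
  ℕ.≤-antisym (ℕ.≮⇒≥ (excluded l^1+k∤n l^j∣n)) (ℕ.≮⇒≥ (excluded l^1+j∤n l^k∣n))
  where
  excluded : ∀ {j k} → (l ℕ.^ suc j) ℕᵈ.∤ n → (l ℕ.^ k) ℕᵈ.∣ n → ¬ j ℕ.< k
  excluded l^1+j∤n l^k∣n j<k = l^1+j∤n (ℕᵈ.∣-trans (^-monoʳ-∣ l j<k) l^k∣n)

order-unique : ∀ {c ℓ} (G : AbelianGroup c ℓ) {g m n} → let open GroupNotions G in
               IsOrder g m → IsOrder g n → m ≡ n
order-unique G (0<m , mg≈ε , m-least) (0<n , ng≈ε , n-least) =
  ℕ.≤-antisym (m-least _ 0<n ng≈ε) (n-least _ 0<m mg≈ε)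

infinite-order⇒independent : ∀ {c ℓ} (G : AbelianGroup c ℓ) {g} → let open GroupNotions G in
  HasInfiniteOrder g → LinearlyIndependent {1} (λ _ → g)
infinite-order⇒independent G {g} inf c cg≈ε Fin.zero = decidable-stable (c Fin.zero ℤ.≟ 0ℤ) λ c≢0 →
  inf (ℤ-Module.nonzero-multiple⇒torsion G c≢0 (trans (sym (identityʳ _)) cg≈ε))
  where open AbelianGroup G

-- Reduction at a prime, and consequences of (A1) and (A2)

module Target {ℓ} {F : NumberField ℓ} {B : AbelianGroup ℓ ℓ} (r : ReductionFamily F B)
              (v : ReductionFamily.Index r) where
  open ReductionFamily r using (target; red; red-hom)
  private module GB = GroupNotions B
  open AbelianGroup (target v) public hiding (_-_)
  open GroupNotions (target v) public
  open ℤ-Module (target v) public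
  open IsGroupHomomorphism (red-hom v) public

  red-·ℕ : ∀ n g → red v (n GB.·ℕ g) ≈ n ·ℕ red v g
  red-·ℕ zero    g = ε-homo
  red-·ℕ (suc n) g = trans (homo g (n GB.·ℕ g)) (∙-congˡ (red-·ℕ n g))

  red-· : ∀ k g → red v (k GB.· g) ≈ k · red v g
  red-· (+ n)    g = red-·ℕ n g
  red-· -[1+ n ] g = trans (⁻¹-homo (suc n GB.·ℕ g)) (⁻¹-cong (red-·ℕ (suc n) g))

  red-sum : ∀ {m} (s : Fin m → ℤ) (G : Fin m → AbelianGroup.Carrier B) →
            red v (GB.sum (λ i → s i GB.· G i)) ≈ sum (λ i → s i · red v (G i))
  red-sum {zero}  s G = ε-homo
  red-sum {suc m} s G = trans (homo (s Fin.zero GB.· G Fin.zero) _)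
    (∙-cong (red-· (s Fin.zero) (G Fin.zero)) (red-sum (s ∘ Fin.suc) (G ∘ Fin.suc)))

module Reduction {ℓ} (em : ExcludedMiddle ℓ) {F : NumberField ℓ} {B : AbelianGroup ℓ ℓ}
                 (r : ReductionFamily F B) where
  open AbelianGroup B hiding (_-_)
  open GroupNotions B
  open ReductionFamily r
  open ℤ-Module B using (·-comm; ·-kill)

  ¬¬-elim : ∀ {A : Set ℓ} → ¬ ¬ A → A
  ¬¬-elim = decidable-stable em

  exists-outside-list : ∀ (S : Pred Index ℓ) → ¬ (Σ[ E ∈ List Index ] (∀ v → v ∈ S → v ∈ˡ E)) →
                        ∀ E → ∃[ v ] v ∈ S × v ∉ E
  exists-outside-list S inf E = ¬¬-elim λ none → inf (E , λ v v∈S → ¬¬-elim λ v∉E → none (v , v∈S , v∉E))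

  -- At a single `v` outside the exceptional list the torsion of B embeds into the finite group
  -- `target v`, whose exponent therefore kills it.
  torsion-exponent : A2 → ∃[ n ] 0 ℕ.< n × (∀ T → IsTorsion T → n ·ℕ T ≈ ε)
  torsion-exponent (E , inj) =
    let v , _ , v∉E = exists-outside-list (λ _ → ⊤) (λ (E , all) → index-infinite (E , λ v → all v _)) E
        module T = Target r v
        n , 0<n , kills = T.finite⇒exponent (target-finite v)
    in n , 0<n , λ T tors → inj v v∉E (n ·ℕ T) ε (multiple-torsion n tors)
      (1 , s≤s z≤n , identityʳ ε) (T.trans (T.red-·ℕ n T) (T.trans (kills (red v T)) (T.sym T.ε-homo)))
    where
    multiple-torsion : ∀ n {T} → IsTorsion T → IsTorsion (n ·ℕ T)
    multiple-torsion n {T} (m , 0<m , mT≈ε) =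
      m , 0<m , trans (·-comm (+ m) (+ n) T) (·-kill (+ n) mT≈ε)

  nonempty : ∀ {S : Pred (PrimeOf F) ℓ} → HasPositiveDensity S →
             ∃[ x ] ∃[ 𝔭 ] 𝔭 ∈ (S ∩ NormAtMost x)
  nonempty (δ , pos , num , den , num-card , den-card , lim) =
    let _ , N , bound = limit-bound {num} {den} {δ} pos lim
        f , f∈ , _ = num-card N
        i = Fin.fromℕ< (proj₁ (bound N ℕ.≤-refl))
    in N , f i , f∈ i

  ≐ᴾ-sym : Symmetric (_≐ᴾ_ {F = F})
  ≐ᴾ-sym (p⊆q , q⊆p) = q⊆p , p⊆q

  ≐ᴾ-trans : Transitive (_≐ᴾ_ {F = F})
  ≐ᴾ-trans (p⊆q , q⊆p) (q⊆r , r⊆q) = (λ x∈p → q⊆r (p⊆q x∈p)) , λ x∈r → q⊆p (r⊆q x∈r)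

  -- A set of positive density contained in a finite list would bound the number
  -- of primes of norm ≤ x. But the nonempty sets of v with 2 ^ k ∥ ord_v P, for
  -- k = 1, 2, …, are pairwise disjoint.
  module _ (a1 : A1) {P} (P-infinite : HasInfiniteOrder P) where

    distinct-primes : ∀ C → ∃[ x ] Σ[ 𝔭 ∈ (Fin C → PrimeOf F) ]
                      (∀ i → 𝔭 i ∈ NormAtMost x) × Injective _≡_ _≐ᴾ_ 𝔭
    distinct-primes C = proj₁ norms-bounded , prime ,
      (λ i → let n , n≤x , norm = proj₂ (proj₂ (proj₂ (element i)))
             in n , ℕ.≤-trans n≤x (proj₂ norms-bounded i) , norm) ,
      λ {i} {j} e → Fin.toℕ-injective (ℕ.suc-injective (exponents-agree i j e))
      where
      class : ∀ i → _
      class i = a1 2 prime-2 1 (λ _ → suc (toℕ i)) (λ _ → P) (infinite-order⇒independent B P-infinite)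
      element : ∀ (i : Fin C) → _
      element i = nonempty (proj₁ (proj₂ (class i)))
      norms-bounded = finite-maximum (λ i → proj₁ (element i))
      prime : Fin C → PrimeOf F
      prime i = proj₁ (proj₂ (element i))
      index : Fin C → Index
      index i = proj₁ (proj₁ (proj₂ (proj₂ (element i))))
      order : ∀ i → ∃[ n ] HasOrd (index i) P n × 2 ^ suc (toℕ i) ∥ n
      order i = let n , ord , exact , _ = proj₂ (proj₂ (class i)) (index i)
                      (proj₁ (proj₂ (proj₁ (proj₂ (proj₂ (element i)))))) Fin.zero
                in n , ord , exact (s≤s z≤n)
      exponents-agree : ∀ i j → prime i ≐ᴾ prime j → suc (toℕ i) ≡ suc (toℕ j)
      exponents-agree i j e =
        -- By `primeAt-inj` equal primes come from the same index, so both exact powers of 2 concern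
        -- one and the same order.
        let at i = proj₂ (proj₂ (proj₁ (proj₂ (proj₂ (element i)))))
            same = primeAt-inj (≐ᴾ-trans {primeAt (index i)} {prime i} {primeAt (index j)} (at i)
                     (≐ᴾ-trans {prime i} {prime j} {primeAt (index j)} e
                       (≐ᴾ-sym {primeAt (index j)} {prime j} (at j))))
            m , ord-m , 2^i∥m = order i
            n , ord-n , 2^j∥n = order j
            m≡n = order-unique (target (index i)) ord-m
                    (≡.subst (λ v → HasOrd v P n) (≡.sym same) ord-n)
        in exact-power-unique {2} 2^i∥m (≡.subst (2 ^ suc (toℕ j) ∥_) (≡.sym m≡n) 2^j∥n)

    positive-density⇒infinite : ∀ {S : Pred Index ℓ} → HasPositiveDensity (primesAt S) →
                                ¬ (Σ[ E ∈ List Index ] (∀ v → v ∈ S → v ∈ˡ E))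
    positive-density⇒infinite {S} (δ , pos , num , den , num-card , den-card , lim) (E , S⊆E) =
      ℕ.<-irrefl ≡.refl (ℕ.≤-trans (injection⇒≤-cardinality
        (λ {𝔭} {𝔮} → ≐ᴾ-sym {𝔭} {𝔮}) (λ {𝔭} {𝔮} {𝔯} → ≐ᴾ-trans {𝔭} {𝔮} {𝔯}) (den-card X) 𝔭
        (λ i → let n , n≤x , norm = 𝔭-norm i in n , ℕ.≤-trans n≤x (ℕ.m≤m⊔n x N) , norm) 𝔭-inj)
        (ℕ.≤-trans (proj₂ (bound X (ℕ.m≤n⊔m x N))) (ℕ.*-monoˡ-≤ D (num≤ X))))
      where
      bounds = limit-bound {num} {den} {δ} pos lim
      D = proj₁ bounds
      N = proj₁ (proj₂ bounds)
      bound = proj₂ (proj₂ bounds)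
      -- If `S` lay in `E`, there would be at most `length E · D` primes of norm at most `X`; one
      -- more than that is requested.
      primes = distinct-primes (suc (length E ℕ.* D))
      x = proj₁ primes
      𝔭 = proj₁ (proj₂ primes)
      𝔭-norm = proj₁ (proj₂ (proj₂ primes))
      𝔭-inj : Injective _≡_ _≐ᴾ_ 𝔭
      𝔭-inj = proj₂ (proj₂ (proj₂ primes))
      X = x ℕ.⊔ N
      num≤ : ∀ x → num x ℕ.≤ length E
      num≤ x = let f , f∈ , f-inj , _ = num-card x
                   v i = proj₁ (proj₁ (f∈ i))
                   v∈E i = S⊆E (v i) (proj₁ (proj₂ (proj₁ (f∈ i))))
                   at i = proj₂ (proj₂ (proj₁ (f∈ i)))
               in Fin.injective⇒≤ {f = λ i → Any.index (v∈E i)} λ {i} {j} e →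
                    let same = Membershipₚ.index-injective (≡.setoid Index) (v∈E i) (v∈E j) e
                    in f-inj (≐ᴾ-trans {f i} {primeAt (v i)} {f j} (≐ᴾ-sym {primeAt (v i)} {f i} (at i))
                         (≡.subst (λ w → primeAt w ≐ᴾ f j) (≡.sym same) (at j)))

    -- For v given by (A1), with l ^ k ∥ ord_v G₀ and the other orders prime to l, some
    -- multiple prime to l kills all terms but s₀ G₀ modulo v.
    coefficient-divisible : Prime l → ∀ {k} → 0 ℕ.< k → ∀ {m} (G : Fin (suc m) → Carrier) →
      LinearlyIndependent G → ∀ E → ∃[ v ] v ∉ E ×
      (∀ t s → Target._≈_ r v (red v (t · sum (λ i → s i · G i))) (Target.ε r v) →
        + (l ℕ.^ k) ∣ t * s Fin.zero)
    coefficient-divisible {l} pl {k} 0<k {m} G indep E = v , v∉E , divisible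
      where
      exponents : Fin (suc m) → ℕ
      exponents Fin.zero    = k
      exponents (Fin.suc i) = 0
      class = a1 l pl (suc m) exponents G indep
      outside = exists-outside-list (proj₁ class) (positive-density⇒infinite (proj₁ (proj₂ class))) E
      v = proj₁ outside
      v∉E = proj₂ (proj₂ outside)
      orders = proj₂ (proj₂ class) v (proj₁ (proj₂ outside))
      module T = Target r v
      h : Fin (suc m) → T.Carrier
      h i = red v (G i)
      divisible : ∀ t s → red v (t · sum (λ i → s i · G i)) T.≈ T.ε →
                  + (l ℕ.^ k) ∣ t * s Fin.zero
      divisible t s e =
        let n , (ord , exact , _) = orders Fin.zero
            M , l∤M , Mrest≈ε = T.kill-sum pl (s ∘ Fin.suc) (h ∘ Fin.suc) λ i →
              let n , ((_ , nh≈ε , _) , _ , l∤n) = orders (Fin.suc i)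
              in n , (λ d → l∤n ≡.refl (∣⇒∣ᵤ d)) , nh≈ε
            rest = T.sum (λ i → s (Fin.suc i) T.· h (Fin.suc i))
            n∣ : + n ∣ t * (M * s Fin.zero)
            n∣ = T.order-divides ord _ (begin
              (t * (M * s Fin.zero)) T.· h Fin.zero
                ≈⟨ T.·-assoc t _ _ ⟩
              t T.· ((M * s Fin.zero) T.· h Fin.zero)
                ≈⟨ T.·-congˡ t (T.·-assoc M _ _) ⟩
              t T.· (M T.· (s Fin.zero T.· h Fin.zero))
                ≈⟨ T.·-congˡ t (T.trans (T.sym (T.identityʳ _)) (T.∙-congˡ (T.sym Mrest≈ε))) ⟩
              t T.· (M T.· (s Fin.zero T.· h Fin.zero) T.∙ M T.· rest)
                ≈⟨ T.·-congˡ t (T.·-distrib-∙ M _ _) ⟨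
              t T.· (M T.· T.sum (λ i → s i T.· h i))
                ≈⟨ T.·-comm t M _ ⟩
              M T.· (t T.· T.sum (λ i → s i T.· h i))
                ≈⟨ T.·-kill M (T.trans (T.·-congˡ t (T.sym (T.red-sum s G)))
                     (T.trans (T.sym (T.red-· t _)) e)) ⟩
              T.ε ∎)
        in prime-power-cancel pl l∤M k {t * s Fin.zero} (≡.subst (+ (l ℕ.^ k) ∣_) (swap t M (s Fin.zero))
             (∣-trans (∣ᵤ⇒∣ (proj₁ (exact 0<k))) n∣))
        where
        open import Relation.Binary.Reasoning.Setoid T.setoid
        swap : ∀ a b c → a * (b * c) ≡ b * (a * c)
        swap = solve-∀

-- The local-global principle in B

lower-excluded-middle : ∀ {ℓ} → ExcludedMiddle ℓ → ExcludedMiddle 0ℓ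
lower-excluded-middle {ℓ} em {A} = map′ lower lift (em {Lift ℓ A})

squares : ℤ³ → ℤ³
squares (x , y , z) = x * x , y * y , z * z

-- Unlike the nested gcd, this condition is visibly invariant under permuting the coordinates, as
-- the rotations and swaps of P, Q, R require.
Primitive : ℤ³ → Set
Primitive v = ∀ {d} → d ∣³ v → d ∣ 1ℤ

triple-≡ : ∀ {a b c a′ b′ c′ : ℤ} → a ≡ a′ → b ≡ b′ → c ≡ c′ → (a , b , c) ≡ (a′ , b′ , c′)
triple-≡ ≡.refl ≡.refl ≡.refl = ≡.refl

gcd≡1⇒primitive : ∀ {x y z} → gcd x (gcd y z) ≡ 1ℤ → Primitive (x , y , z)
gcd≡1⇒primitive {x} {y} {z} e {d} (d∣x , d∣y , d∣z) = ∣ᵤ⇒∣ (≡.subst (λ g → ℤ.∣ d ∣ ℕᵈ.∣ ℤ.∣ g ∣) e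
  (gcd-greatest {x} {gcd y z} {d} (∣⇒∣ᵤ d∣x) (gcd-greatest {y} {z} {d} (∣⇒∣ᵤ d∣y) (∣⇒∣ᵤ d∣z))))

primitive-part : ∀ v → ¬ 0ℤ ∣³ v → ∃[ g ] ∃[ x ] ∃[ y ] ∃[ z ]
  g ≢ 0ℤ × v ≡ g *³ (x , y , z) × gcd x (gcd y z) ≡ 1ℤ
primitive-part (x , y , z) v≢0 = part (∣ᵤ⇒∣ {g} {x} (gcd[i,j]∣i x (gcd y z)))
    (∣-trans {g} {gcd y z} {y} (∣ᵤ⇒∣ (gcd[i,j]∣j x (gcd y z))) (∣ᵤ⇒∣ (gcd[i,j]∣i y z)))
    (∣-trans {g} {gcd y z} {z} (∣ᵤ⇒∣ (gcd[i,j]∣j x (gcd y z))) (∣ᵤ⇒∣ (gcd[i,j]∣j y z)))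
  where
  g = gcd x (gcd y z)
  g≢0 : g ≢ 0ℤ
  g≢0 e = v≢0 ( ∣-reflexive (≡.sym (gcd[i,j]≡0⇒i≡0 x (gcd y z) e))
              , ∣-reflexive (≡.sym (gcd[i,j]≡0⇒i≡0 y z (gcd[i,j]≡0⇒j≡0 {x} e)))
              , ∣-reflexive (≡.sym (gcd[i,j]≡0⇒j≡0 {y} {z} (gcd[i,j]≡0⇒j≡0 {x} e))))
  part : g ∣ x → g ∣ y → g ∣ z → ∃[ g ] ∃[ x′ ] ∃[ y′ ] ∃[ z′ ]
    g ≢ 0ℤ × (x , y , z) ≡ g *³ (x′ , y′ , z′) × gcd x′ (gcd y′ z′) ≡ 1ℤ
  part (divides x′ ex) (divides y′ ey) (divides z′ ez) =
    g , x′ , y′ , z′ , g≢0 ,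
    triple-≡ (≡.trans ex (ℤ.*-comm x′ g)) (≡.trans ey (ℤ.*-comm y′ g)) (≡.trans ez (ℤ.*-comm z′ g)) ,
    ≡.cong +_ (ℕᵈ.∣1⇒≡1 (∣⇒∣ᵤ e∣1))
    where
    e = gcd x′ (gcd y′ z′)
    up : ∀ {u} u′ → u ≡ u′ * g → e ∣ u′ → e * g ∣ u
    up u′ eq h = ≡.subst (e * g ∣_) (≡.sym eq) (*-monoˡ-∣ g h)
    e∣gcd : e ∣ gcd y′ z′
    e∣gcd = ∣ᵤ⇒∣ (gcd[i,j]∣j x′ (gcd y′ z′))
    eg∣g : e * g ∣ g
    eg∣g = ∣ᵤ⇒∣ (gcd-greatest {x} {gcd y z} {e * g}
      (∣⇒∣ᵤ (up x′ ex (∣ᵤ⇒∣ (gcd[i,j]∣i x′ (gcd y′ z′)))))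
      (gcd-greatest {y} {z} {e * g}
        (∣⇒∣ᵤ (up y′ ey (∣-trans {e} {gcd y′ z′} {y′} e∣gcd (∣ᵤ⇒∣ (gcd[i,j]∣i y′ z′)))))
        (∣⇒∣ᵤ (up z′ ez (∣-trans {e} {gcd y′ z′} {z′} e∣gcd (∣ᵤ⇒∣ (gcd[i,j]∣j y′ z′)))))))
    e∣1 : e ∣ 1ℤ
    e∣1 = *-cancelʳ-∣ g {e} {1ℤ} ⦃ ℤ.≢-nonZero g≢0 ⦄
      (≡.subst (e * g ∣_) (≡.sym (ℤ.*-identityˡ g)) eg∣g)

module Main {ℓ} (em : ExcludedMiddle ℓ) {F : NumberField ℓ} {B : AbelianGroup ℓ ℓ}
            (r : ReductionFamily F B) (a1 : ReductionFamily.A1 r) (a2 : ReductionFamily.A2 r) where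
  open AbelianGroup B hiding (_-_)
  open GroupNotions B
  open ReductionFamily r
  open ℤ-Module B
  open Reduction em r
  open SquareCriterion (lower-excluded-middle em)
  open Legendre (lower-excluded-middle em)

  torsion-resp : ∀ {g h} → g ≈ h → IsTorsion g → IsTorsion h
  torsion-resp g≈h (n , 0<n , e) = n , 0<n , trans (·-congˡ (+ n) (sym g≈h)) e

  torsion-divide : ∀ {k g} → k ≢ 0ℤ → IsTorsion (k · g) → IsTorsion g
  torsion-divide {k} {g} k≢0 (n , 0<n , e) = nonzero-multiple⇒torsion
    (*-≢0 (λ n≡0 → ℕ.<⇒≢ 0<n (≡.sym (ℤ.+-injective n≡0))) k≢0) (trans (·-assoc (+ n) k g) e)

  ε-torsion : ∀ {g} → g ≈ ε → IsTorsion g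
  ε-torsion e = 1 , s≤s z≤n , trans (identityʳ _) e

  open Combination hiding (sum³; sum-combination; combination-cong)

  SolvableLocally : (P Q R : Carrier) → Set ℓ
  SolvableLocally P Q R = AllButFinitelyMany λ v →
    ∃[ w ] ∃[ T ] Primitive w × IsTorsion T × combination P Q R (squares w) ≈[ v ] T

  -- A nonzero triple is enough: a common factor `g` multiplies the combination by `g²`, and
  -- dividing by a nonzero integer keeps a torsion point torsion. The point T is the combination
  -- itself.
  SolvableGlobally : (P Q R : Carrier) → Set ℓ
  SolvableGlobally P Q R = ∃[ w ] ¬ 0ℤ ∣³ w × IsTorsion (combination P Q R (squares w))

  combination-rotate : ∀ P Q R a b c → combination Q R P (b , c , a) ≈ combination P Q R (a , b , c)
  combination-rotate P Q R a b c = trans (comm _ _) (sym (assoc _ _ _))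

  combination-swap : ∀ P Q R a b c → combination Q P R (b , a , c) ≈ combination P Q R (a , b , c)
  combination-swap P Q R a b c = ∙-congʳ (comm _ _)

  rotate-locally : ∀ {P Q R} → SolvableLocally P Q R → SolvableLocally Q R P
  rotate-locally {P} {Q} {R} (E , sol) = E , λ v v∉E →
    let (x , y , z) , T , prim , tors , e = sol v v∉E
        module T = Target r v
    in (y , z , x) , T , (λ (dy , dz , dx) → prim (dx , dy , dz)) , tors ,
       T.trans (T.⟦⟧-cong (combination-rotate P Q R (x * x) (y * y) (z * z))) e

  swap-locally : ∀ {P Q R} → SolvableLocally P Q R → SolvableLocally Q P R
  swap-locally {P} {Q} {R} (E , sol) = E , λ v v∉E →
    let (x , y , z) , T , prim , tors , e = sol v v∉E
        module T = Target r v
    in (y , x , z) , T , (λ (dy , dx , dz) → prim (dx , dy , dz)) , tors ,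
       T.trans (T.⟦⟧-cong (combination-swap P Q R (x * x) (y * y) (z * z))) e

  rotate-globally : ∀ {P Q R} → SolvableGlobally Q R P → SolvableGlobally P Q R
  rotate-globally {P} {Q} {R} ((y , z , x) , w≢0 , tors) =
    (x , y , z) , (λ (dx , dy , dz) → w≢0 (dy , dz , dx)) ,
    torsion-resp (combination-rotate P Q R (x * x) (y * y) (z * z)) tors

  module _ (P Q R : Carrier) (P-infinite : HasInfiniteOrder P) (loc : SolvableLocally P Q R) where
    open Combination P Q R using (sum³; sum-combination; combination-cong)

    private
      C : ℤ³ → Carrier
      C = combination P Q R

    -- Modulo relations between P, Q and R, d times a value of the quadratic map
    -- has coordinates with respect to the family g, of which q is the first.
    FirstCoordinate : ∀ {m} → (Fin (suc m) → ℤ³) → ℤ → ℤ³ → Set ℓ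
    FirstCoordinate {m} g d q = ∀ w → Σ[ s ∈ (Fin (suc m) → ℤ) ] s Fin.zero ≡ diag q w ×
      ∃[ u ] C u ≈ ε × d *³ squares w ≡ sum³ (λ i → s i *³ g i) +³ u

    expand : ∀ {m} {g : Fin (suc m) → ℤ³} {d q} → FirstCoordinate g d q → ∀ w →
             Σ[ s ∈ (Fin (suc m) → ℤ) ] s Fin.zero ≡ diag q w ×
             d · C (squares w) ≈ sum (λ i → s i · C (g i))
    expand {g = g} {d} coord w = let s , s₀ , u , u≈ε , e = coord w in s , s₀ , (begin
      d · C (squares w)                        ≈⟨ combination-* P Q R d (squares w) ⟨
      C (d *³ squares w)                       ≈⟨ combination-cong e ⟩
      C (sum³ (λ i → s i *³ g i) +³ u)         ≈⟨ combination-+ P Q R (sum³ (λ i → s i *³ g i)) u ⟩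
      C (sum³ (λ i → s i *³ g i)) ∙ C u        ≈⟨ ∙-cong (sym (sum-combination s g)) u≈ε ⟩
      sum (λ i → s i · C (g i)) ∙ ε            ≈⟨ identityʳ _ ⟩
      sum (λ i → s i · C (g i))                ∎)
      where open import Relation.Binary.Reasoning.Setoid setoid

    locally-isotropic : ∀ {m} (g : Fin (suc m) → ℤ³) → LinearlyIndependent (λ i → C (g i)) →
                        ∀ d q → FirstCoordinate g d q → LocallyIsotropic q
    locally-isotropic {m} g indep d q coord {l} pl = 1 , λ k →
      let n , 0<n , kills = torsion-exponent a2
          E , sol = loc
          -- The power `k + n` pays for cancelling the torsion exponent `n` afterwards, and n > 0
          -- keeps it positive even for k = 0, as the exact divisibility in (A1) demands.
          v , v∉E , divisible = coefficient-divisible a1 P-infinite pl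
            (ℕ.≤-trans 0<n (ℕ.m≤n+m n k)) (λ i → C (g i)) indep E
          w , T , prim , tors , e = sol v v∉E
          s , s₀ , expansion = expand {g = g} {d} {q} coord w
          n≢0 = λ n≡0 → ℕ.<⇒≢ 0<n (≡.sym (ℤ.+-injective n≡0))
      in w ,
         ≡.subst (+ (l ℕ.^ k) ∣_) s₀ (power-cancel pl {+ n} n≢0 k
           (divisible (+ n) s (vanishes v T tors w s e expansion n kills))) ,
         λ h → contradiction (ℕᵈ.∣1⇒≡1 (∣⇒∣ᵤ (prim h)))
           (ℕ.>⇒≢ (≡.subst (1 ℕ.<_) (≡.sym (ℕ.*-identityʳ l)) (prime>1 pl)))
      where
      -- `n` is moved inside `d` so that it meets the torsion point; the result is `d` times an
      -- element that already vanishes at `v`.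
      vanishes : ∀ v T → IsTorsion T → ∀ w (s : Fin (suc m) → ℤ) → C (squares w) ≈[ v ] T →
        d · C (squares w) ≈ sum (λ i → s i · C (g i)) →
        ∀ n → (∀ T → IsTorsion T → n ·ℕ T ≈ ε) →
        Target._≈_ r v (red v ((+ n) · sum (λ i → s i · C (g i)))) (Target.ε r v)
      vanishes v T tors w s e expansion n kills = begin
        red v ((+ n) · sum (λ i → s i · C (g i)))
          ≈⟨ T.⟦⟧-cong (·-congˡ (+ n) expansion) ⟨
        red v ((+ n) · (d · C (squares w)))
          ≈⟨ T.⟦⟧-cong (·-comm (+ n) d (C (squares w))) ⟩
        red v (d · ((+ n) · C (squares w)))
          ≈⟨ T.trans (T.red-· d _) (T.·-congˡ d (T.red-· (+ n) _)) ⟩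
        d T.· ((+ n) T.· red v (C (squares w)))
          ≈⟨ T.·-congˡ d (T.·-congˡ (+ n) e) ⟩
        d T.· ((+ n) T.· red v T)
          ≈⟨ T.·-kill d (T.trans (T.sym (T.red-· (+ n) T)) (T.trans (T.⟦⟧-cong (kills T tors)) T.ε-homo)) ⟩
        T.ε ∎
        where
        module T = Target r v
        open import Relation.Binary.Reasoning.Setoid T.setoid

    combination-kill : ∀ k u → C u ≈ ε → C (k *³ u) ≈ ε
    combination-kill k u e = trans (combination-* P Q R k u) (·-kill k e)

    independent : ∀ {m} (g : Fin m → ℤ³) →
      (∀ c → C (sum³ (λ i → c i *³ g i)) ≈ ε → ∀ i → c i ≡ 0ℤ) →
      LinearlyIndependent (λ i → C (g i))
    independent g h c e = h c (trans (sym (sum-combination c g)) e)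

    P-free : ∀ {a} → C (a , 0ℤ , 0ℤ) ≈ ε → a ≡ 0ℤ
    P-free {a} e = decidable-stable (a ℤ.≟ 0ℤ) λ a≢0 → P-infinite
      (nonzero-multiple⇒torsion a≢0 (trans (sym (trans (identityʳ _) (identityʳ _))) e))

    no-relation : ¬ (∀ u → C u ≈ ε → 0ℤ ∣³ u)
    no-relation free = three-squares-anisotropic 0ℤ
      (locally-isotropic g (independent g indep) 1ℤ (1ℤ , 1ℤ , 1ℤ) coord prime-2)
      where
      g : Fin 3 → ℤ³
      g = (1ℤ , 0ℤ , 0ℤ) Vector.∷ (-1ℤ , 1ℤ , 0ℤ) Vector.∷ (-1ℤ , 0ℤ , 1ℤ) Vector.∷ Vector.[]
      i₁ i₂ : Fin 3
      i₁ = Fin.suc Fin.zero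
      i₂ = Fin.suc (Fin.suc Fin.zero)
      coord : FirstCoordinate g 1ℤ (1ℤ , 1ℤ , 1ℤ)
      coord w@(x , y , z) = (diag (1ℤ , 1ℤ , 1ℤ) w Vector.∷ y * y Vector.∷ z * z Vector.∷ Vector.[]) , ≡.refl ,
        (0ℤ , 0ℤ , 0ℤ) , combination-0 P Q R , triple-≡ (lem₁ x y z) (lem₂ x y z) (lem₃ x y z)
        where
        lem₁ : ∀ x y z → 1ℤ * (x * x) ≡
          (1ℤ * (x * x) + 1ℤ * (y * y) + 1ℤ * (z * z)) * 1ℤ + (y * y * -1ℤ + (z * z * -1ℤ + 0ℤ)) + 0ℤ
        lem₁ = solve-∀
        lem₂ : ∀ x y z → 1ℤ * (y * y) ≡
          (1ℤ * (x * x) + 1ℤ * (y * y) + 1ℤ * (z * z)) * 0ℤ + (y * y * 1ℤ + (z * z * 0ℤ + 0ℤ)) + 0ℤ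
        lem₂ = solve-∀
        lem₃ : ∀ x y z → 1ℤ * (z * z) ≡
          (1ℤ * (x * x) + 1ℤ * (y * y) + 1ℤ * (z * z)) * 0ℤ + (y * y * 0ℤ + (z * z * 1ℤ + 0ℤ)) + 0ℤ
        lem₃ = solve-∀
      indep : ∀ c → C (sum³ (λ i → c i *³ g i)) ≈ ε → ∀ i → c i ≡ 0ℤ
      indep c e = λ { Fin.zero → c₀ ; (Fin.suc Fin.zero) → c₁ ; (Fin.suc (Fin.suc Fin.zero)) → c₂ }
        where
        a = c Fin.zero
        b = c i₁
        d = c i₂
        h = free (sum³ (λ i → c i *³ g i)) e
        e₂ : ∀ a b d → a * 0ℤ + (b * 0ℤ + (d * 1ℤ + 0ℤ)) ≡ d
        e₂ = solve-∀
        e₁ : ∀ a b d → a * 0ℤ + (b * 1ℤ + (d * 0ℤ + 0ℤ)) ≡ b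
        e₁ = solve-∀
        e₀ : ∀ a b d → a * 1ℤ + (b * -1ℤ + (d * -1ℤ + 0ℤ)) + b + d ≡ a
        e₀ = solve-∀
        c₂ : d ≡ 0ℤ
        c₂ = ≡.trans (≡.sym (e₂ a b d)) (0∣⇒≡0 (proj₂ (proj₂ h)))
        c₁ : b ≡ 0ℤ
        c₁ = ≡.trans (≡.sym (e₁ a b d)) (0∣⇒≡0 (proj₁ (proj₂ h)))
        c₀ : a ≡ 0ℤ
        c₀ = ≡.trans (≡.sym (e₀ a b d)) (≡.cong₂ _+_ (≡.cong₂ _+_ (0∣⇒≡0 (proj₁ h)) c₁) c₂)

    module _ α β {γ} (γ≢0 : γ ≢ 0ℤ) (relation : C (α , β , γ) ≈ ε) where

      one-relation⇒square : (∀ a b → C (a , b , 0ℤ) ≈ ε → a ≡ 0ℤ × b ≡ 0ℤ) → ∃[ s ] α * γ ≡ s * s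
      one-relation⇒square free = square-criterion α β γ≢0 λ c →
        locally-isotropic (g c) (independent (g c) (indep c)) γ (relation-form α β γ c) (coord c)
        where
        g : ℤ → Fin 2 → ℤ³
        g c = (1ℤ , 0ℤ , 0ℤ) Vector.∷ (- c , 1ℤ , 0ℤ) Vector.∷ Vector.[]
        coord : ∀ c → FirstCoordinate (g c) γ (relation-form α β γ c)
        -- Subtracting z² times the relation from γ(x²P + y²Q + z²R) removes R, and the remaining
        -- multiple of Q is split by Q = (Q - cP) + cP.
        coord c w@(x , y , z) =
          (diag (relation-form α β γ c) w Vector.∷ γ * (y * y) - β * (z * z) Vector.∷ Vector.[]) , ≡.refl ,
          (z * z) *³ (α , β , γ) , combination-kill (z * z) (α , β , γ) relation ,
          triple-≡ (lem₁ α β γ c x y z) (lem₂ α β γ c x y z) (lem₃ α β γ c x y z)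
          where
          lem₁ : ∀ α β γ c x y z → γ * (x * x) ≡
            (γ * (x * x) + γ * c * (y * y) + - (α + β * c) * (z * z)) * 1ℤ
              + ((γ * (y * y) - β * (z * z)) * - c + 0ℤ) + z * z * α
          lem₁ = solve-∀
          lem₂ : ∀ α β γ c x y z → γ * (y * y) ≡
            (γ * (x * x) + γ * c * (y * y) + - (α + β * c) * (z * z)) * 0ℤ
              + ((γ * (y * y) - β * (z * z)) * 1ℤ + 0ℤ) + z * z * β
          lem₂ = solve-∀
          lem₃ : ∀ α β γ c x y z → γ * (z * z) ≡
            (γ * (x * x) + γ * c * (y * y) + - (α + β * c) * (z * z)) * 0ℤ
              + ((γ * (y * y) - β * (z * z)) * 0ℤ + 0ℤ) + z * z * γ
          lem₃ = solve-∀
        indep : ∀ c s → C (sum³ (λ i → s i *³ g c i)) ≈ ε → ∀ i → s i ≡ 0ℤ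
        indep c s e = λ { Fin.zero → s₀≡0 ; (Fin.suc Fin.zero) → s₁≡0 }
          where
          s₀ = s Fin.zero
          s₁ = s (Fin.suc Fin.zero)
          e₁ : ∀ a b → a * 0ℤ + (b * 1ℤ + 0ℤ) ≡ b
          e₁ = solve-∀
          e₂ : ∀ a b → a * 0ℤ + (b * 0ℤ + 0ℤ) ≡ 0ℤ
          e₂ = solve-∀
          e₀ : ∀ a b c → a * 1ℤ + (b * - c + 0ℤ) + c * b ≡ a
          e₀ = solve-∀
          h = free (s₀ * 1ℤ + (s₁ * - c + 0ℤ)) (s₀ * 0ℤ + (s₁ * 1ℤ + 0ℤ))
            (trans (combination-cong
              {s₀ * 1ℤ + (s₁ * - c + 0ℤ) , s₀ * 0ℤ + (s₁ * 1ℤ + 0ℤ) , 0ℤ} {sum³ (λ i → s i *³ g c i)}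
              (triple-≡ ≡.refl ≡.refl (≡.sym (e₂ s₀ s₁)))) e)
          s₁≡0 : s₁ ≡ 0ℤ
          s₁≡0 = ≡.trans (≡.sym (e₁ s₀ s₁)) (proj₂ h)
          s₀≡0 : s₀ ≡ 0ℤ
          s₀≡0 = ≡.trans (≡.sym (e₀ s₀ s₁ c)) (≡.cong₂ _+_ (proj₁ h)
            (≡.trans (≡.cong (c *_) s₁≡0) (ℤ.*-zeroʳ c)))

      squares⇒solvable : (∃[ s ] α * γ ≡ s * s) → (∃[ t ] β * γ ≡ t * t) → SolvableGlobally P Q R
      squares⇒solvable (s , αγ≡s²) (t , βγ≡t²) =
        (s , t , γ) , (λ h → γ≢0 (0∣⇒≡0 (proj₂ (proj₂ h)))) , ε-torsion (trans (combination-cong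
          {s * s , t * t , γ * γ} {γ *³ (α , β , γ)} (triple-≡
            (≡.trans (≡.sym αγ≡s²) (ℤ.*-comm α γ)) (≡.trans (≡.sym βγ≡t²) (ℤ.*-comm β γ)) ≡.refl))
          (combination-kill γ (α , β , γ) relation))

      two-relations⇒solvable : ∀ a b → C (a , b , 0ℤ) ≈ ε → b ≢ 0ℤ → SolvableGlobally P Q R
      two-relations⇒solvable a b relation′ b≢0 = conclude
        (locally-isotropic⇒isotropic q (locally-isotropic g (independent g indep) (γ * b) q coord))
        where
        q : ℤ³
        q = γ * b , - (γ * a) , β * a - α * b
        g : Fin 1 → ℤ³
        g _ = 1ℤ , 0ℤ , 0ℤ
        coord : FirstCoordinate g (γ * b) q
        coord w@(x , y , z) = (λ _ → diag q w) , ≡.refl ,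
          -- The first relation, taken b z² times, removes R. This leaves b(γy² - βz²) as
          -- coefficient of Q, which the second relation removes.
          (z * z * b) *³ (α , β , γ) +³ (γ * (y * y) - β * (z * z)) *³ (a , b , 0ℤ) ,
          trans (combination-+ P Q R ((z * z * b) *³ (α , β , γ)) ((γ * (y * y) - β * (z * z)) *³ (a , b , 0ℤ)))
            (trans (∙-cong (combination-kill (z * z * b) (α , β , γ) relation)
              (combination-kill (γ * (y * y) - β * (z * z)) (a , b , 0ℤ) relation′)) (identityˡ ε)) ,
          triple-≡ (lem₁ α β γ a b x y z) (lem₂ α β γ a b x y z) (lem₃ α β γ a b x y z)
          where
          lem₁ : ∀ α β γ a b x y z → γ * b * (x * x) ≡
            (γ * b * (x * x) + - (γ * a) * (y * y) + (β * a - α * b) * (z * z)) * 1ℤ + 0ℤ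
              + (z * z * b * α + (γ * (y * y) - β * (z * z)) * a)
          lem₁ = solve-∀
          lem₂ : ∀ α β γ a b x y z → γ * b * (y * y) ≡
            (γ * b * (x * x) + - (γ * a) * (y * y) + (β * a - α * b) * (z * z)) * 0ℤ + 0ℤ
              + (z * z * b * β + (γ * (y * y) - β * (z * z)) * b)
          lem₂ = solve-∀
          lem₃ : ∀ α β γ a b x y z → γ * b * (z * z) ≡
            (γ * b * (x * x) + - (γ * a) * (y * y) + (β * a - α * b) * (z * z)) * 0ℤ + 0ℤ
              + (z * z * b * γ + (γ * (y * y) - β * (z * z)) * 0ℤ)
          lem₃ = solve-∀
        indep : ∀ c → C (sum³ (λ i → c i *³ g i)) ≈ ε → ∀ i → c i ≡ 0ℤ
        indep c e Fin.zero = P-free (trans (combination-cong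
          (triple-≡ (≡.sym (lem₁ a₀)) (≡.sym (lem₀ a₀)) (≡.sym (lem₀ a₀)))) e)
          where
          a₀ = c Fin.zero
          lem₁ : ∀ a → a * 1ℤ + 0ℤ ≡ a
          lem₁ = solve-∀
          lem₀ : ∀ a → a * 0ℤ + 0ℤ ≡ 0ℤ
          lem₀ = solve-∀
        conclude : Isotropic q → SolvableGlobally P Q R
        conclude (w , qw≡0 , w≢0) = let s , s₀ , e = expand {g = g} {γ * b} {q} coord w in
          w , w≢0 , nonzero-multiple⇒torsion (*-≢0 γ≢0 b≢0) (trans e (trans (identityʳ _)
            (·-congʳ (C (g Fin.zero)) (≡.trans s₀ qw≡0))))

  -- Whether P and Q satisfy a relation of their own decides between rank 1 and rank 2. In rank 2,
  -- exchanging P and Q turns the argument for αγ into the one for βγ.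
  solvable-by-relation : ∀ P Q R → HasInfiniteOrder P → HasInfiniteOrder Q → SolvableLocally P Q R →
    ∀ α β {γ} → γ ≢ 0ℤ → combination P Q R (α , β , γ) ≈ ε → SolvableGlobally P Q R
  solvable-by-relation P Q R P-inf Q-inf loc α β {γ} γ≢0 relation =
    split (em {∃[ a ] ∃[ b ] combination P Q R (a , b , 0ℤ) ≈ ε × ¬ (a ≡ 0ℤ × b ≡ 0ℤ)})
    where
    split : Dec (∃[ a ] ∃[ b ] combination P Q R (a , b , 0ℤ) ≈ ε × ¬ (a ≡ 0ℤ × b ≡ 0ℤ)) →
            SolvableGlobally P Q R
    split (yes (a , b , relation′ , nonzero)) =
      two-relations⇒solvable P Q R P-inf loc α β γ≢0 relation a b relation′ b≢0
      where
      b≢0 : b ≢ 0ℤ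
      b≢0 b≡0 = nonzero (P-free P Q R P-inf loc
        (trans (·-pad b≡0) relation′) , b≡0)
        where
        ·-pad : b ≡ 0ℤ → combination P Q R (a , 0ℤ , 0ℤ) ≈ combination P Q R (a , b , 0ℤ)
        ·-pad ≡.refl = refl
    split (no none) = squares⇒solvable P Q R P-inf loc α β γ≢0 relation
      (one-relation⇒square P Q R P-inf loc α β γ≢0 relation free)
      (one-relation⇒square Q P R Q-inf (swap-locally loc) β α γ≢0
        (trans (combination-swap P Q R α β γ) relation)
        λ b a e → let a≡0 , b≡0 = free a b (trans (sym (combination-swap P Q R a b 0ℤ)) e) in b≡0 , a≡0)
      where
      free : ∀ a b → combination P Q R (a , b , 0ℤ) ≈ ε → a ≡ 0ℤ × b ≡ 0ℤ
      free a b e with a ℤ.≟ 0ℤ | b ℤ.≟ 0ℤ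
      ... | yes a≡0 | yes b≡0 = a≡0 , b≡0
      ... | no a≢0  | _       = ⊥-elim (none (a , b , e , λ h → a≢0 (proj₁ h)))
      ... | yes _   | no b≢0  = ⊥-elim (none (a , b , e , λ h → b≢0 (proj₂ h)))

  locally⇒globally : ∀ P Q R → HasInfiniteOrder P → HasInfiniteOrder Q → HasInfiniteOrder R →
                     SolvableLocally P Q R → SolvableGlobally P Q R
  locally⇒globally P Q R P-inf Q-inf R-inf loc = split (em {∃[ u ] combination P Q R u ≈ ε × ¬ 0ℤ ∣³ u})
    where
    split : Dec (∃[ u ] combination P Q R u ≈ ε × ¬ 0ℤ ∣³ u) → SolvableGlobally P Q R
    split (no none) = ⊥-elim (no-relation P Q R P-inf loc λ u e →
      decidable-stable (0ℤ ∣³? u) λ u≢0 → none (u , e , u≢0))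
    -- The points are rotated until a nonzero coefficient stands in the last place.
    split (yes ((α , β , γ) , e , nonzero)) with γ ℤ.≟ 0ℤ | β ℤ.≟ 0ℤ | α ℤ.≟ 0ℤ
    ... | no γ≢0 | _ | _ = solvable-by-relation P Q R P-inf Q-inf loc α β γ≢0 e
    ... | yes _ | no β≢0 | _ = rotate-globally (rotate-globally
      (solvable-by-relation R P Q R-inf P-inf (rotate-locally (rotate-locally loc)) γ α β≢0
        (trans (sym (combination-rotate R P Q γ α β)) e)))
    ... | yes _ | yes _ | no α≢0 = rotate-globally
      (solvable-by-relation Q R P Q-inf R-inf (rotate-locally loc) β γ α≢0
        (trans (combination-rotate P Q R α β γ) e))
    ... | yes γ≡0 | yes β≡0 | yes α≡0 = ⊥-elim (nonzero
      (∣-reflexive (≡.sym α≡0) , ∣-reflexive (≡.sym β≡0) , ∣-reflexive (≡.sym γ≡0)))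

  primitive-solution-globally : ∀ P Q R → SolvableGlobally P Q R →
    ∃[ x ] ∃[ y ] ∃[ z ] gcd x (gcd y z) ≡ 1ℤ × IsTorsion (combination P Q R (squares (x , y , z)))
  primitive-solution-globally P Q R (w , w≢0 , tors) = divide (primitive-part w w≢0)
    where
    lem : ∀ g x → g * x * (g * x) ≡ g * g * (x * x)
    lem = solve-∀
    divide : (∃[ g ] ∃[ x ] ∃[ y ] ∃[ z ] g ≢ 0ℤ × w ≡ g *³ (x , y , z) × gcd x (gcd y z) ≡ 1ℤ) → _
    divide (g , x , y , z , g≢0 , ≡.refl , prim) =
      x , y , z , prim , torsion-divide (*-≢0 g≢0 g≢0)
        (torsion-resp (trans
          (Combination.combination-cong P Q R (triple-≡ (lem g x) (lem g y) (lem g z)))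
          (combination-* P Q R (g * g) (squares (x , y , z)))) tors)

square-as-power : ∀ x → x ^ 2 ≡ x * x
square-as-power x = ≡.cong (x *_) (ℤ.*-identityʳ x)

theorem3p1 : ∀ {ℓ} → ExcludedMiddle ℓ →
    (F : NumberField ℓ) (B : AbelianGroup ℓ ℓ) (r : ReductionFamily F B) →
    let open AbelianGroup B
        open GroupNotions B
        open ReductionFamily r
    in
    A1 → A2 →
    (P Q R : Carrier) → HasInfiniteOrder P → HasInfiniteOrder Q → HasInfiniteOrder R →
    (AllButFinitelyMany λ v →
      ∃[ x ] ∃[ y ] ∃[ z ] ∃[ T ] gcd x (gcd y z) ≡ 1ℤ × IsTorsion T ×
        ((x ^ 2) · P ∙ (y ^ 2) · Q ∙ (z ^ 2) · R) ≈[ v ] T)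
    ⇔
    (∃[ x ] ∃[ y ] ∃[ z ] ∃[ T ] gcd x (gcd y z) ≡ 1ℤ × IsTorsion T ×
      ((x ^ 2) · P ∙ (y ^ 2) · Q ∙ (z ^ 2) · R) ≈ T)
theorem3p1 em F B r a1 a2 P Q R P-inf Q-inf R-inf = mk⇔
  (λ (E , sol) →
    let x , y , z , prim , tors = primitive-solution-globally P Q R
          (locally⇒globally P Q R P-inf Q-inf R-inf (E , λ v v∉E →
            let x , y , z , T , prim , tors , e = sol v v∉E
                module T = Target r v
            in (x , y , z) , T , gcd≡1⇒primitive {x} {y} {z} prim , tors ,
               T.trans (T.⟦⟧-cong (B.sym (powers x y z))) e))
    in x , y , z , _ , prim , tors , powers x y z)
  (λ (x , y , z , T , prim , tors , e) → [] , λ v _ →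
    x , y , z , T , prim , tors , Target.⟦⟧-cong r v e)
  where
  module B = AbelianGroup B
  open Main em r a1 a2
  open GroupNotions B
  open ℤ-Module.Combination B P Q R
  powers : ∀ x y z → combination (x ^ 2 , y ^ 2 , z ^ 2) B.≈ combination (squares (x , y , z))
  powers x y z = combination-cong
    (triple-≡ (square-as-power x) (square-as-power y) (square-as-power z))
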